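{- For every positive integer $n$, we have $$\operatorname{Cond}(V_n) = \frac{n}{\operatorname{rad}(n)}\, \operatorname{Cond}(V_{\operatorname{rad}(n)}),$$ where $\operatorname{rad}(n)$ denotes the product of all (distinct) prime factors of $n$, and $V_n$ is the Vandermonde matrix associated with the $n$th cyclotomic polynomial.
   Context: For a positive integer $n$, let $m := \varphi(n)$ (Euler's totient function) and let $\zeta_1, \dots, \zeta_m \in \mathbb{C}$ be the primitive $n$th roots of unity (listed in any fixed order). The Vandermonde matrix associated with the $n$th cyclotomic polynomial is the $m \times m$ complex matrix $V_n := (\zeta_i^{\,j-1})_{1 \leq i,j \leq m}$; it is invertible since the $\zeta_i$ are distinct. The condition number of an invertible complex $k \times k$ matrix $A = (a_{i,j})$ is $\operatorname{Cond}(A) := \|A\|\,\|A^{ -1}\|$, where $\|A\| := \sqrt{\sum_{i=1}^k \sum_{j=1}^k |a_{i,j}|^2} = \sqrt{\operatorname{Tr}(A^*A)}$ is the Frobenius norm and $A^*$ is the conjugate transpose of $A$. By convention $\operatorname{rad}(1) = 1$ (empty product). -}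

module Defs where

open import Algebra.Bundles.Raw using (RawRing)
import Algebra.Definitions.RawSemiring as RawSemiringDefs
open import Data.Bool.Base using (if_then_else_)
open import Data.Empty using (⊥-elim)
open import Data.Fin.Base using (Fin; toℕ)
open import Data.Fin.Properties as Fin using ()
open import Data.Integer.Base as ℤ using (+_)
import Data.Integer.Properties as ℤ
open import Data.List.Base using (List; filter; length; map; upTo)
open import Data.List.Relation.Unary.All as All using ()
import Data.List.Relation.Unary.All.Properties as All
open import Data.Nat.Base as ℕ using (ℕ; zero; suc; NonZero)
open import Data.Nat.Coprimality using (coprime?)
open import Data.Nat.Divisibility using (_∣_; _∣?_)
open import Data.Nat.ListAction using (product)
open import Data.Nat.ListAction.Properties using (product≢0)
open import Data.Nat.Primality using (prime?; prime⇒nonZero)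
import Data.Nat.Properties as ℕ
open import Data.Product.Base using (Σ-syntax; ∃-syntax; _×_; _,_; proj₁; proj₂)
open import Data.Rational.Base as ℚ using (ℚ; 0ℚ; 1ℚ; ½; ∣_∣; _/_; toℚᵘ)
import Data.Rational.Properties as ℚ
open import Data.Rational.Solver using (module +-*-Solver)
import Data.Rational.Unnormalised.Base as ℚᵘ
import Data.Rational.Unnormalised.Properties as ℚᵘ
open import Data.Sum.Base using (_⊎_; inj₁; inj₂)
open import Function.Base using (_∘_; _⟨_⟩_; case_of_)
open import Level using (0ℓ)
open import Relation.Binary.PropositionalEquality
  using (_≡_; refl; sym; trans; cong; cong₂; subst; subst₂)
open import Relation.Nullary.Decidable using (yes; no; _×-dec_; ⌊_⌋)
open import Relation.Nullary.Negation using (¬_)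

φ : ℕ → ℕ
φ n = length (filter (λ k → coprime? k n) (map suc (upTo n)))

primeDivisors : ℕ → List ℕ
primeDivisors n = filter (λ p → prime? p ×-dec p ∣? n) (upTo (suc n))

-- For n ≥ 1 every prime divisor of n is at most n, so `primeDivisors n`
-- lists each of them exactly once.
rad : ℕ → ℕ
rad n = product (primeDivisors n)

rad-nonZero : ∀ n → NonZero (rad n)
rad-nonZero n = product≢0
  (All.map (prime⇒nonZero ∘ proj₁) (All.all-filter (λ p → prime? p ×-dec p ∣? n) (upTo (suc n))))

abstract

  half-pos : ∀ {ε} → 0ℚ ℚ.< ε → 0ℚ ℚ.< ½ ℚ.* ε
  half-pos {ε} 0<ε = subst (ℚ._< ½ ℚ.* ε) (ℚ.*-zeroʳ ½) (ℚ.*-monoʳ-<-pos ½ 0<ε)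

  half+half : ∀ ε → ½ ℚ.* ε ℚ.+ ½ ℚ.* ε ≡ ε
  half+half ε = trans (sym (ℚ.*-distribʳ-+ ε ½ ½)) (ℚ.*-identityˡ ε)

  *-pos : ∀ {p q} → 0ℚ ℚ.< p → 0ℚ ℚ.< q → 0ℚ ℚ.< p ℚ.* q
  *-pos {p} {q} 0<p 0<q = subst (ℚ._< p ℚ.* q) (ℚ.*-zeroʳ p)
    (ℚ.*-monoʳ-<-pos p {{ℚ.positive 0<p}} 0<q)

  *-mono-≤ : ∀ {p q r s} → 0ℚ ℚ.≤ p → 0ℚ ℚ.≤ r → p ℚ.≤ q → r ℚ.≤ s → p ℚ.* r ℚ.≤ q ℚ.* s
  *-mono-≤ {p} {q} {r} {s} 0≤p 0≤r p≤q r≤s = ℚ.≤-trans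
    (ℚ.*-monoʳ-≤-nonNeg r {{ℚ.nonNegative 0≤r}} p≤q)
    (ℚ.*-monoˡ-≤-nonNeg q {{ℚ.nonNegative (ℚ.≤-trans 0≤p p≤q)}} r≤s)

  ∣p-q∣≡∣q-p∣ : ∀ p q → ∣ p ℚ.- q ∣ ≡ ∣ q ℚ.- p ∣
  ∣p-q∣≡∣q-p∣ p q = trans (sym (ℚ.∣-p∣≡∣p∣ (p ℚ.- q)))
    (cong ∣_∣ (solve 2 (λ p q → :- (p :- q) := q :- p) refl p q))
    where open +-*-Solver

  p≤∣p∣ : ∀ p → p ℚ.≤ ∣ p ∣
  p≤∣p∣ p = case ℚ.≤-total 0ℚ p of λ where
    (inj₁ 0≤p) → ℚ.≤-reflexive (sym (ℚ.0≤p⇒∣p∣≡p 0≤p))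
    (inj₂ p≤0) → ℚ.≤-trans p≤0 (ℚ.0≤∣p∣ p)

  ∣-∣-< : ∀ {p r} → p ℚ.< r → ℚ.- p ℚ.< r → ∣ p ∣ ℚ.< r
  ∣-∣-< {p} {r} p<r -p<r = case ℚ.∣p∣≡p∨∣p∣≡-p p of λ where
    (inj₁ eq) → subst (ℚ._< r) (sym eq) p<r
    (inj₂ eq) → subst (ℚ._< r) (sym eq) -p<r

-- Real numbers are Cauchy sequences of rationals, two of them being equal
-- when their difference tends to zero.

IsCauchy : (ℕ → ℚ) → Set
IsCauchy x = ∀ ε → 0ℚ ℚ.< ε →
  Σ[ N ∈ ℕ ] (∀ m n → N ℕ.≤ m → N ℕ.≤ n → ∣ x m ℚ.- x n ∣ ℚ.< ε)

record ℝ : Set where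
  constructor mkℝ
  field
    seq    : ℕ → ℚ
    cauchy : IsCauchy seq

open ℝ public

infix 4 _≈ᵣ_

_≈ᵣ_ : ℝ → ℝ → Set
x ≈ᵣ y = ∀ ε → 0ℚ ℚ.< ε →
  Σ[ N ∈ ℕ ] (∀ n → N ℕ.≤ n → ∣ seq x n ℚ.- seq y n ∣ ℚ.< ε)

abstract

  const-cauchy : ∀ q → IsCauchy (λ _ → q)
  const-cauchy q ε 0<ε = 0 , λ _ _ _ _ → subst (ℚ._< ε) (cong ∣_∣ (sym (ℚ.+-inverseʳ q))) 0<ε

  neg-cauchy : ∀ {x} → IsCauchy x → IsCauchy (λ n → ℚ.- x n)
  neg-cauchy {x} cx ε 0<ε = proj₁ (cx ε 0<ε) , λ m n N≤m N≤n →
    subst (ℚ._< ε) (trans (∣p-q∣≡∣q-p∣ (x m) (x n)) (cong ∣_∣ (lemma (x m) (x n))))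
      (proj₂ (cx ε 0<ε) m n N≤m N≤n)
    where
    open +-*-Solver
    lemma : ∀ p q → q ℚ.- p ≡ (ℚ.- p) ℚ.- (ℚ.- q)
    lemma = solve 2 (λ p q → q :- p := (:- p) :- (:- q)) refl

  +-cauchy : ∀ {x y} → IsCauchy x → IsCauchy y → IsCauchy (λ n → x n ℚ.+ y n)
  +-cauchy {x} {y} cx cy ε 0<ε =
    let M , p = cx (½ ℚ.* ε) (half-pos 0<ε)
        N , q = cy (½ ℚ.* ε) (half-pos 0<ε)
    in M ℕ.⊔ N , λ m n l l′ → begin-strict
      ∣ (x m ℚ.+ y m) ℚ.- (x n ℚ.+ y n) ∣
        ≡⟨ cong ∣_∣ (lemma (x m) (y m) (x n) (y n)) ⟩
      ∣ (x m ℚ.- x n) ℚ.+ (y m ℚ.- y n) ∣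
        ≤⟨ ℚ.∣p+q∣≤∣p∣+∣q∣ (x m ℚ.- x n) (y m ℚ.- y n) ⟩
      ∣ x m ℚ.- x n ∣ ℚ.+ ∣ y m ℚ.- y n ∣
        <⟨ ℚ.+-mono-< (p m n (ℕ.m⊔n≤o⇒m≤o M N l) (ℕ.m⊔n≤o⇒m≤o M N l′))
                      (q m n (ℕ.m⊔n≤o⇒n≤o M N l) (ℕ.m⊔n≤o⇒n≤o M N l′)) ⟩
      ½ ℚ.* ε ℚ.+ ½ ℚ.* ε
        ≡⟨ half+half ε ⟩
      ε ∎
    where
    open ℚ.≤-Reasoning
    open +-*-Solver
    lemma : ∀ a b c d → (a ℚ.+ b) ℚ.- (c ℚ.+ d) ≡ (a ℚ.- c) ℚ.+ (b ℚ.- d)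
    lemma = solve 4 (λ a b c d → (a :+ b) :- (c :+ d) := (a :- c) :+ (b :- d)) refl

  eventually-bounded : ∀ {x} → IsCauchy x →
    Σ[ B ∈ ℚ ] 0ℚ ℚ.< B × Σ[ N ∈ ℕ ] (∀ n → N ℕ.≤ n → ∣ x n ∣ ℚ.≤ B)
  eventually-bounded {x} cx =
    let N , p = cx 1ℚ (ℚ.positive⁻¹ 1ℚ)
    in 1ℚ ℚ.+ ∣ x N ∣ , ℚ.+-mono-<-≤ (ℚ.positive⁻¹ 1ℚ) (ℚ.0≤∣p∣ (x N)) , N , λ n N≤n → begin
      ∣ x n ∣                       ≡⟨ cong ∣_∣ (lemma (x n) (x N)) ⟩
      ∣ (x n ℚ.- x N) ℚ.+ x N ∣     ≤⟨ ℚ.∣p+q∣≤∣p∣+∣q∣ (x n ℚ.- x N) (x N) ⟩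
      ∣ x n ℚ.- x N ∣ ℚ.+ ∣ x N ∣   ≤⟨ ℚ.+-monoˡ-≤ ∣ x N ∣ (ℚ.<⇒≤ (p n N N≤n ℕ.≤-refl)) ⟩
      1ℚ ℚ.+ ∣ x N ∣                ∎
    where
    open ℚ.≤-Reasoning
    open +-*-Solver
    lemma : ∀ a b → a ≡ (a ℚ.- b) ℚ.+ b
    lemma = solve 2 (λ a b → a := (a :- b) :+ b) refl

  split-between : ∀ {B C ε} → 0ℚ ℚ.< B → 0ℚ ℚ.< C → 0ℚ ℚ.< ε →
    Σ[ δ ∈ ℚ ] 0ℚ ℚ.< δ × B ℚ.* δ ℚ.+ C ℚ.* δ ≡ ε
  split-between {B} {C} {ε} 0<B 0<C 0<ε = 1/D ℚ.* ε
    , *-pos (ℚ.positive⁻¹ 1/D {{ℚ.1/pos⇒pos D {{D-pos}}}}) 0<ε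
    , trans (sym (ℚ.*-distribʳ-+ (1/D ℚ.* ε) B C))
      (trans (sym (ℚ.*-assoc D 1/D ε))
      (trans (cong (ℚ._* ε) (ℚ.*-inverseʳ D {{D-nonZero}})) (ℚ.*-identityˡ ε)))
    where
    D : ℚ
    D = B ℚ.+ C
    D-pos : ℚ.Positive D
    D-pos = ℚ.positive (ℚ.+-mono-< 0<B 0<C)
    D-nonZero : ℚ.NonZero D
    D-nonZero = ℚ.pos⇒nonZero D {{D-pos}}
    1/D : ℚ
    1/D = (ℚ.1/ D) {{D-nonZero}}

  ∣p*q∣-< : ∀ {b δ} p q → ∣ p ∣ ℚ.≤ b → 0ℚ ℚ.< b → ∣ q ∣ ℚ.< δ → ∣ p ℚ.* q ∣ ℚ.< b ℚ.* δ
  ∣p*q∣-< {b} {δ} p q p≤b 0<b q<δ = begin-strict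
    ∣ p ℚ.* q ∣       ≡⟨ ℚ.∣p*q∣≡∣p∣*∣q∣ p q ⟩
    ∣ p ∣ ℚ.* ∣ q ∣   ≤⟨ ℚ.*-monoʳ-≤-nonNeg ∣ q ∣ {{ℚ.nonNegative (ℚ.0≤∣p∣ q)}} p≤b ⟩
    b ℚ.* ∣ q ∣       <⟨ ℚ.*-monoʳ-<-pos b {{ℚ.positive 0<b}} q<δ ⟩
    b ℚ.* δ           ∎
    where open ℚ.≤-Reasoning

  ∣ab-cd∣-< : ∀ {B C δ ε} a b c d → 0ℚ ℚ.< B → 0ℚ ℚ.< C → B ℚ.* δ ℚ.+ C ℚ.* δ ≡ ε →
    ∣ a ∣ ℚ.≤ B → ∣ d ∣ ℚ.≤ C → ∣ a ℚ.- c ∣ ℚ.< δ → ∣ b ℚ.- d ∣ ℚ.< δ →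
    ∣ a ℚ.* b ℚ.- c ℚ.* d ∣ ℚ.< ε
  ∣ab-cd∣-< {B} {C} {δ} {ε} a b c d 0<B 0<C eq a≤B d≤C ac bd = begin-strict
    ∣ a ℚ.* b ℚ.- c ℚ.* d ∣
      ≡⟨ cong ∣_∣ (lemma a b c d) ⟩
    ∣ a ℚ.* (b ℚ.- d) ℚ.+ d ℚ.* (a ℚ.- c) ∣
      ≤⟨ ℚ.∣p+q∣≤∣p∣+∣q∣ (a ℚ.* (b ℚ.- d)) (d ℚ.* (a ℚ.- c)) ⟩
    ∣ a ℚ.* (b ℚ.- d) ∣ ℚ.+ ∣ d ℚ.* (a ℚ.- c) ∣
      <⟨ ℚ.+-mono-< (∣p*q∣-< a (b ℚ.- d) a≤B 0<B bd) (∣p*q∣-< d (a ℚ.- c) d≤C 0<C ac) ⟩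
    B ℚ.* δ ℚ.+ C ℚ.* δ
      ≡⟨ eq ⟩
    ε ∎
    where
    open ℚ.≤-Reasoning
    open +-*-Solver
    lemma : ∀ a b c d → a ℚ.* b ℚ.- c ℚ.* d ≡ a ℚ.* (b ℚ.- d) ℚ.+ d ℚ.* (a ℚ.- c)
    lemma = solve 4 (λ a b c d → a :* b :- c :* d := a :* (b :- d) :+ d :* (a :- c)) refl

  *-cauchy : ∀ {x y} → IsCauchy x → IsCauchy y → IsCauchy (λ n → x n ℚ.* y n)
  *-cauchy {x} {y} cx cy ε 0<ε =
    let B , 0<B , K , xB = eventually-bounded {x} cx
        C , 0<C , L , yC = eventually-bounded {y} cy
        δ , 0<δ , eq = split-between 0<B 0<C 0<ε
        M , p = cx δ 0<δ
        N , q = cy δ 0<δ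
    in (K ℕ.⊔ L) ℕ.⊔ (M ℕ.⊔ N) , λ m n l l′ →
      ∣ab-cd∣-< (x m) (y m) (x n) (y n) 0<B 0<C eq
        (xB m (ℕ.m⊔n≤o⇒m≤o K L (ℕ.m⊔n≤o⇒m≤o (K ℕ.⊔ L) (M ℕ.⊔ N) l)))
        (yC n (ℕ.m⊔n≤o⇒n≤o K L (ℕ.m⊔n≤o⇒m≤o (K ℕ.⊔ L) (M ℕ.⊔ N) l′)))
        (p m n (ℕ.m⊔n≤o⇒m≤o M N (ℕ.m⊔n≤o⇒n≤o (K ℕ.⊔ L) (M ℕ.⊔ N) l))
               (ℕ.m⊔n≤o⇒m≤o M N (ℕ.m⊔n≤o⇒n≤o (K ℕ.⊔ L) (M ℕ.⊔ N) l′)))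
        (q m n (ℕ.m⊔n≤o⇒n≤o M N (ℕ.m⊔n≤o⇒n≤o (K ℕ.⊔ L) (M ℕ.⊔ N) l))
               (ℕ.m⊔n≤o⇒n≤o M N (ℕ.m⊔n≤o⇒n≤o (K ℕ.⊔ L) (M ℕ.⊔ N) l′)))

fromℚ : ℚ → ℝ
fromℚ q = mkℝ (λ _ → q) (const-cauchy q)

infixl 6 _+ᵣ_
infixl 7 _*ᵣ_
infix  8 -ᵣ_

_+ᵣ_ : ℝ → ℝ → ℝ
x +ᵣ y = mkℝ (λ n → seq x n ℚ.+ seq y n) (+-cauchy {seq x} {seq y} (cauchy x) (cauchy y))

_*ᵣ_ : ℝ → ℝ → ℝ
x *ᵣ y = mkℝ (λ n → seq x n ℚ.* seq y n) (*-cauchy {seq x} {seq y} (cauchy x) (cauchy y))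

-ᵣ_ : ℝ → ℝ
-ᵣ x = mkℝ (λ n → ℚ.- seq x n) (neg-cauchy {seq x} (cauchy x))

ℝ-rawRing : RawRing 0ℓ 0ℓ
ℝ-rawRing = record
  { Carrier = ℝ ; _≈_ = _≈ᵣ_ ; _+_ = _+ᵣ_ ; _*_ = _*ᵣ_ ; -_ = -ᵣ_
  ; 0# = fromℚ 0ℚ ; 1# = fromℚ 1ℚ }

-- The last among g 1, …, g k whose square does not exceed q; it is 0 when
-- there is none.
sqrtBelow : (ℕ → ℚ) → ℚ → ℕ → ℚ
sqrtBelow g q zero    = 0ℚ
sqrtBelow g q (suc k) =
  if ⌊ g (suc k) ℚ.* g (suc k) ℚ.≤? q ⌋ then g (suc k) else sqrtBelow g q k

grid : ℕ → ℕ → ℚ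
grid n k = + k / suc n

-- The search bound k = (n+1)(|num q|+1) satisfies q < (k/(n+1))², so for
-- q ≥ 0 the value is within 1/(n+1) of the square root of q.
sqrtApprox : ℕ → ℚ → ℚ
sqrtApprox n q = sqrtBelow (grid n) q (suc n ℕ.* suc ℤ.∣ ℚ.↥ q ∣)

abstract

  /-suc : ∀ k n → + suc k / suc n ≡ + k / suc n ℚ.+ + 1 / suc n
  /-suc k n = ℚ.toℚᵘ-injective (begin
    toℚᵘ (+ suc k / suc n)                              ≈⟨ ℚ.toℚᵘ-fromℚᵘ (+ suc k ℚᵘ./ suc n) ⟩
    + suc k ℚᵘ./ suc n                                  ≈⟨ ℚᵘ.*≡* eq ⟩
    (+ k ℚᵘ./ suc n) ℚᵘ.+ (+ 1 ℚᵘ./ suc n)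
      ≈⟨ ℚᵘ.+-cong (ℚ.toℚᵘ-fromℚᵘ (+ k ℚᵘ./ suc n)) (ℚ.toℚᵘ-fromℚᵘ (+ 1 ℚᵘ./ suc n)) ⟨
    toℚᵘ (+ k / suc n) ℚᵘ.+ toℚᵘ (+ 1 / suc n)          ≈⟨ ℚ.toℚᵘ-homo-+ (+ k / suc n) (+ 1 / suc n) ⟨
    toℚᵘ (+ k / suc n ℚ.+ + 1 / suc n)                  ∎)
    where
    open ℚᵘ.≃-Reasoning
    eq : + suc k ℤ.* (+ suc n ℤ.* + suc n) ≡ (+ k ℤ.* + suc n ℤ.+ + 1 ℤ.* + suc n) ℤ.* + suc n
    eq = trans (sym (ℤ.*-assoc (+ suc k) (+ suc n) (+ suc n)))
      (cong (ℤ._* + suc n)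
        (trans (cong (ℤ._* + suc n) (cong +_ (ℕ.+-comm 1 k))) (ℤ.*-distribʳ-+ (+ suc n) (+ k) (+ 1))))

  1/suc-pos : ∀ n → 0ℚ ℚ.< + 1 / suc n
  1/suc-pos n = ℚ.positive⁻¹ (+ 1 / suc n) {{ℚ.normalize-pos 1 (suc n)}}

  /-nonNeg : ∀ k n → 0ℚ ℚ.≤ + k / suc n
  /-nonNeg k n = ℚ.nonNegative⁻¹ (+ k / suc n) {{ℚ.normalize-nonNeg k (suc n)}}

  sqrtBelow-nonNeg : ∀ g q k → (∀ i → 0ℚ ℚ.≤ g i) → 0ℚ ℚ.≤ sqrtBelow g q k
  sqrtBelow-nonNeg g q zero    0≤g = ℚ.≤-refl
  sqrtBelow-nonNeg g q (suc k) 0≤g with g (suc k) ℚ.* g (suc k) ℚ.≤? q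
  ... | yes _ = 0≤g (suc k)
  ... | no  _ = sqrtBelow-nonNeg g q k 0≤g

  sqrtBelow-lower : ∀ g q k →
    sqrtBelow g q k ≡ 0ℚ ⊎ sqrtBelow g q k ℚ.* sqrtBelow g q k ℚ.≤ q
  sqrtBelow-lower g q zero    = inj₁ refl
  sqrtBelow-lower g q (suc k) with g (suc k) ℚ.* g (suc k) ℚ.≤? q
  ... | yes p = inj₂ p
  ... | no  _ = sqrtBelow-lower g q k

  sqrtBelow-upper : ∀ g h q k → g 1 ≡ h → (∀ i → g (suc i) ≡ g i ℚ.+ h) →
    q ℚ.< g (suc k) ℚ.* g (suc k) →
    q ℚ.< (sqrtBelow g q k ℚ.+ h) ℚ.* (sqrtBelow g q k ℚ.+ h)
  sqrtBelow-upper g h q zero    eq step lt =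
    subst (λ r → q ℚ.< r ℚ.* r) (trans eq (sym (ℚ.+-identityˡ h))) lt
  sqrtBelow-upper g h q (suc k) eq step lt with g (suc k) ℚ.* g (suc k) ℚ.≤? q
  ... | yes _ = subst (λ r → q ℚ.< r ℚ.* r) (step (suc k)) lt
  ... | no ¬p = sqrtBelow-upper g h q k eq step (ℚ.≰⇒> ¬p)

  /-cancel : ∀ n m → + (suc n ℕ.* m) / suc n ≡ + m / 1
  /-cancel n m = ℚ.toℚᵘ-injective (ℚᵘ.≃-trans
    (ℚ.toℚᵘ-fromℚᵘ (+ (suc n ℕ.* m) ℚᵘ./ suc n)) (ℚᵘ.≃-trans
    (ℚᵘ.*≡* (trans (ℤ.*-identityʳ (+ (suc n ℕ.* m))) (cong +_ (ℕ.*-comm (suc n) m))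
       ⟨ trans ⟩ ℤ.pos-* m (suc n)))
    (ℚᵘ.≃-sym (ℚ.toℚᵘ-fromℚᵘ (+ m ℚᵘ./ 1)))))

  ∣↥q∣-bound : ∀ q → q ℚ.≤ + suc ℤ.∣ ℚ.↥ q ∣ / 1
  ∣↥q∣-bound q@record{} = ℚ.toℚᵘ-cancel-≤ (ℚᵘ.≤-trans (ℚᵘ.*≤* bound)
    (ℚᵘ.≤-reflexive (ℚᵘ.≃-sym (ℚ.toℚᵘ-fromℚᵘ (+ suc ℤ.∣ ℚ.↥ q ∣ ℚᵘ./ 1)))))
    where
    open ℤ.≤-Reasoning
    i≤∣i∣ : ∀ i → i ℤ.≤ + ℤ.∣ i ∣
    i≤∣i∣ (+ _)       = ℤ.≤-refl
    i≤∣i∣ ℤ.-[1+ _ ] = ℤ.-≤+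
    bound : ℚ.↥ q ℤ.* + 1 ℤ.≤ + suc ℤ.∣ ℚ.↥ q ∣ ℤ.* ℚ.↧ q
    bound = begin
      ℚ.↥ q ℤ.* + 1                        ≡⟨ ℤ.*-identityʳ (ℚ.↥ q) ⟩
      ℚ.↥ q                                ≤⟨ i≤∣i∣ (ℚ.↥ q) ⟩
      + ℤ.∣ ℚ.↥ q ∣                        ≤⟨ ℤ.+≤+ (ℕ.n≤1+n _) ⟩
      + suc ℤ.∣ ℚ.↥ q ∣                    ≤⟨ ℤ.+≤+ (ℕ.m≤m*n (suc ℤ.∣ ℚ.↥ q ∣) (ℚ.↧ₙ q)) ⟩
      + (suc ℤ.∣ ℚ.↥ q ∣ ℕ.* ℚ.↧ₙ q)       ≡⟨ ℤ.pos-* (suc ℤ.∣ ℚ.↥ q ∣) (ℚ.↧ₙ q) ⟩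
      + suc ℤ.∣ ℚ.↥ q ∣ ℤ.* ℚ.↧ q          ∎

  1≤suc/1 : ∀ m → 1ℚ ℚ.≤ + suc m / 1
  1≤suc/1 m = ℚ.toℚᵘ-cancel-≤ (ℚᵘ.≤-trans (ℚᵘ.*≤* (ℤ.+≤+ (ℕ.s≤s ℕ.z≤n)))
    (ℚᵘ.≤-reflexive (ℚᵘ.≃-sym (ℚ.toℚᵘ-fromℚᵘ (+ suc m ℚᵘ./ 1)))))

  sqrtApprox-nonNeg : ∀ n q → 0ℚ ℚ.≤ sqrtApprox n q
  sqrtApprox-nonNeg n q = sqrtBelow-nonNeg (grid n) q (suc n ℕ.* suc ℤ.∣ ℚ.↥ q ∣) (λ k → /-nonNeg k n)

  sqrtApprox-lower : ∀ n q →
    sqrtApprox n q ≡ 0ℚ ⊎ sqrtApprox n q ℚ.* sqrtApprox n q ℚ.≤ q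
  sqrtApprox-lower n q = sqrtBelow-lower (grid n) q (suc n ℕ.* suc ℤ.∣ ℚ.↥ q ∣)

  sqrtApprox-upper : ∀ n q →
    q ℚ.< (sqrtApprox n q ℚ.+ + 1 / suc n) ℚ.* (sqrtApprox n q ℚ.+ + 1 / suc n)
  sqrtApprox-upper n q = sqrtBelow-upper (grid n) (+ 1 / suc n) q K refl (λ k → /-suc k n) (begin-strict
    q                        ≤⟨ ∣↥q∣-bound q ⟩
    b                        ≡⟨ ℚ.*-identityʳ b ⟨
    b ℚ.* 1ℚ                 ≤⟨ ℚ.*-monoˡ-≤-nonNeg b {{ℚ.nonNegative 0≤b}} (1≤suc/1 ℤ.∣ ℚ.↥ q ∣) ⟩
    b ℚ.* b                  ≤⟨ ℚ.*-monoʳ-≤-nonNeg b {{ℚ.nonNegative 0≤b}} (ℚ.<⇒≤ b<c) ⟩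
    c ℚ.* b                  <⟨ ℚ.*-monoʳ-<-pos c {{ℚ.positive (ℚ.≤-<-trans 0≤b b<c)}} b<c ⟩
    c ℚ.* c                  ∎)
    where
    open ℚ.≤-Reasoning
    K : ℕ
    K = suc n ℕ.* suc ℤ.∣ ℚ.↥ q ∣
    b c : ℚ
    b = + suc ℤ.∣ ℚ.↥ q ∣ / 1
    c = + suc K / suc n
    0≤b : 0ℚ ℚ.≤ b
    0≤b = /-nonNeg (suc ℤ.∣ ℚ.↥ q ∣) 0
    b<c : b ℚ.< c
    b<c = begin-strict
      b                            ≡⟨ ℚ.+-identityʳ b ⟨
      b ℚ.+ 0ℚ                     <⟨ ℚ.+-monoʳ-< b (1/suc-pos n) ⟩
      b ℚ.+ + 1 / suc n            ≡⟨ cong (ℚ._+ + 1 / suc n) (/-cancel n (suc ℤ.∣ ℚ.↥ q ∣)) ⟨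
      + K / suc n ℚ.+ + 1 / suc n  ≡⟨ /-suc K n ⟨
      c                            ∎

  archimedean : ∀ ε → 0ℚ ℚ.< ε → Σ[ N ∈ ℕ ] (∀ n → N ℕ.≤ n → + 1 / suc n ℚ.≤ ε)
  archimedean ε@record{} 0<ε = ℚ.↧ₙ ε , λ n N≤n → ℚ.toℚᵘ-cancel-≤ (ℚᵘ.≤-trans
    (ℚᵘ.≤-reflexive (ℚ.toℚᵘ-fromℚᵘ (+ 1 ℚᵘ./ suc n))) (ℚᵘ.*≤* (bound n N≤n)))
    where
    open ℤ.≤-Reasoning
    1≤↥ε : + 1 ℤ.≤ ℚ.↥ ε
    1≤↥ε = ℤ.i<j⇒suc[i]≤j (subst₂ ℤ._<_ refl (ℤ.*-identityʳ (ℚ.↥ ε)) (ℚ.drop-*<* 0<ε))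
    bound : ∀ n → ℚ.↧ₙ ε ℕ.≤ n → + 1 ℤ.* ℚ.↧ ε ℤ.≤ ℚ.↥ ε ℤ.* + suc n
    bound n N≤n = begin
      + 1 ℤ.* ℚ.↧ ε      ≤⟨ ℤ.*-monoˡ-≤-nonNeg (+ 1) (ℤ.+≤+ (ℕ.m≤n⇒m≤1+n N≤n)) ⟩
      + 1 ℤ.* + suc n    ≤⟨ ℤ.*-monoʳ-≤-nonNeg (+ suc n) 1≤↥ε ⟩
      ℚ.↥ ε ℤ.* + suc n  ∎

  -- If s ≥ t + 2e then, with u = t + h, s ≥ e + u and hence
  -- x - y > s² - u² ≥ e².
  sqrt-separation : ∀ {e h} s t x y → 0ℚ ℚ.< e → 0ℚ ℚ.≤ t → 0ℚ ℚ.< h → h ℚ.≤ e →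
    s ≡ 0ℚ ⊎ s ℚ.* s ℚ.≤ x → y ℚ.< (t ℚ.+ h) ℚ.* (t ℚ.+ h) →
    ∣ x ℚ.- y ∣ ℚ.< e ℚ.* e → ¬ (e ℚ.+ e ℚ.≤ s ℚ.- t)
  sqrt-separation {e} {h} s t x y 0<e 0≤t 0<h h≤e lower upper near far = ℚ.<-irrefl refl (begin-strict
    x                        ≡⟨ solve 2 (λ a b → a := (a :- b) :+ b) refl x y ⟩
    (x ℚ.- y) ℚ.+ y          <⟨ ℚ.+-mono-< (ℚ.≤-<-trans (p≤∣p∣ (x ℚ.- y)) near) upper ⟩
    e ℚ.* e ℚ.+ u ℚ.* u      ≡⟨ cong (ℚ._+ u ℚ.* u) (ℚ.+-identityʳ (e ℚ.* e)) ⟨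
    (e ℚ.* e ℚ.+ 0ℚ) ℚ.+ u ℚ.* u
      ≤⟨ ℚ.+-monoˡ-≤ (u ℚ.* u) (ℚ.+-monoʳ-≤ (e ℚ.* e) (ℚ.+-mono-≤ 0≤eu 0≤eu)) ⟩
    (e ℚ.* e ℚ.+ (e ℚ.* u ℚ.+ e ℚ.* u)) ℚ.+ u ℚ.* u
      ≡⟨ solve 2 (λ e u → (e :* e :+ (e :* u :+ e :* u)) :+ u :* u := (e :+ u) :* (e :+ u)) refl e u ⟩
    (e ℚ.+ u) ℚ.* (e ℚ.+ u)  ≤⟨ *-mono-≤ (ℚ.<⇒≤ 0<e+u) (ℚ.<⇒≤ 0<e+u) e+u≤s e+u≤s ⟩
    s ℚ.* s                  ≤⟨ s²≤x ⟩
    x                        ∎)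
    where
    open ℚ.≤-Reasoning
    open +-*-Solver

    u : ℚ
    u = t ℚ.+ h

    0≤u : 0ℚ ℚ.≤ u
    0≤u = ℚ.+-mono-≤ 0≤t (ℚ.<⇒≤ 0<h)

    0<e+u : 0ℚ ℚ.< e ℚ.+ u
    0<e+u = ℚ.+-mono-<-≤ 0<e 0≤u

    e+u≤s : e ℚ.+ u ℚ.≤ s
    e+u≤s = begin
      e ℚ.+ (t ℚ.+ h)    ≤⟨ ℚ.+-monoʳ-≤ e (ℚ.+-monoʳ-≤ t h≤e) ⟩
      e ℚ.+ (t ℚ.+ e)    ≡⟨ solve 2 (λ e t → e :+ (t :+ e) := (e :+ e) :+ t) refl e t ⟩
      (e ℚ.+ e) ℚ.+ t    ≤⟨ ℚ.+-monoˡ-≤ t far ⟩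
      (s ℚ.- t) ℚ.+ t    ≡⟨ solve 2 (λ a b → (a :- b) :+ b := a) refl s t ⟩
      s                  ∎

    s²≤x : s ℚ.* s ℚ.≤ x
    s²≤x = case lower of λ where
      (inj₁ s≡0) → ⊥-elim (ℚ.<-irrefl (sym s≡0) (ℚ.<-≤-trans 0<e+u e+u≤s))
      (inj₂ le)  → le

    0≤eu : 0ℚ ℚ.≤ e ℚ.* u
    0≤eu = subst (ℚ._≤ e ℚ.* u) (ℚ.*-zeroʳ e)
      (ℚ.*-monoˡ-≤-nonNeg e {{ℚ.nonNegative (ℚ.<⇒≤ 0<e)}} 0≤u)

  sqrtApprox-close : ∀ {e} m n x y → 0ℚ ℚ.< e → + 1 / suc n ℚ.≤ e →
    ∣ x ℚ.- y ∣ ℚ.< e ℚ.* e → sqrtApprox m x ℚ.- sqrtApprox n y ℚ.< e ℚ.+ e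
  sqrtApprox-close m n x y 0<e h≤e near = ℚ.≰⇒>
    (sqrt-separation (sqrtApprox m x) (sqrtApprox n y) x y 0<e (sqrtApprox-nonNeg n y)
      (1/suc-pos n) h≤e (sqrtApprox-lower m x) (sqrtApprox-upper n y) near)

  sqrt-cauchy : ∀ {x} → IsCauchy x → IsCauchy (λ n → sqrtApprox n (x n))
  sqrt-cauchy {x} cx ε 0<ε =
    let e = ½ ℚ.* ε
        0<e = half-pos 0<ε
        M , p = cx (e ℚ.* e) (*-pos 0<e 0<e)
        N , a = archimedean e 0<e
    in M ℕ.⊔ N , λ m n l l′ →
      let s = sqrtApprox m (x m)
          t = sqrtApprox n (x n)
          M≤m = ℕ.m⊔n≤o⇒m≤o M N l
          M≤n = ℕ.m⊔n≤o⇒m≤o M N l′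
      in ∣-∣-<
        (subst (s ℚ.- t ℚ.<_) (half+half ε)
          (sqrtApprox-close m n (x m) (x n) 0<e (a n (ℕ.m⊔n≤o⇒n≤o M N l′)) (p m n M≤m M≤n)))
        (subst₂ ℚ._<_ (neg-sub t s) (half+half ε)
          (sqrtApprox-close n m (x n) (x m) 0<e (a m (ℕ.m⊔n≤o⇒n≤o M N l)) (p n m M≤n M≤m)))
    where
    open +-*-Solver
    neg-sub : ∀ p q → p ℚ.- q ≡ ℚ.- (q ℚ.- p)
    neg-sub = solve 2 (λ p q → p :- q := :- (q :- p)) refl

-- The square root, extended by 0 to negative arguments.
√ : ℝ → ℝ
√ x = mkℝ (λ n → sqrtApprox n (seq x n)) (sqrt-cauchy {seq x} (cauchy x))

record ℂ : Set where
  constructor _+i_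
  field
    re im : ℝ

open ℂ public

infix  4 _≈_
infixl 6 _+ᶜ_
infixl 7 _*ᶜ_
infix  8 -ᶜ_

_≈_ : ℂ → ℂ → Set
z ≈ w = re z ≈ᵣ re w × im z ≈ᵣ im w

0ᶜ 1ᶜ : ℂ
0ᶜ = fromℚ 0ℚ +i fromℚ 0ℚ
1ᶜ = fromℚ 1ℚ +i fromℚ 0ℚ

_+ᶜ_ : ℂ → ℂ → ℂ
z +ᶜ w = (re z +ᵣ re w) +i (im z +ᵣ im w)

_*ᶜ_ : ℂ → ℂ → ℂ
z *ᶜ w = (re z *ᵣ re w +ᵣ -ᵣ (im z *ᵣ im w)) +i (re z *ᵣ im w +ᵣ im z *ᵣ re w)

-ᶜ_ : ℂ → ℂ
-ᶜ z = (-ᵣ re z) +i (-ᵣ im z)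

∣_∣² : ℂ → ℝ
∣ z ∣² = re z *ᵣ re z +ᵣ im z *ᵣ im z

ℂ-rawRing : RawRing 0ℓ 0ℓ
ℂ-rawRing = record
  { Carrier = ℂ ; _≈_ = _≈_ ; _+_ = _+ᶜ_ ; _*_ = _*ᶜ_ ; -_ = -ᶜ_ ; 0# = 0ᶜ ; 1# = 1ᶜ }

open RawSemiringDefs (RawRing.rawSemiring ℝ-rawRing) public
  using () renaming (sum to sumᵣ)
open RawSemiringDefs (RawRing.rawSemiring ℂ-rawRing) public
  using (_^_) renaming (sum to sumᶜ)

Matrix : ℕ → Set
Matrix k = Fin k → Fin k → ℂ

infix  4 _≋_
infixl 7 _·_

_≋_ : ∀ {k} → Matrix k → Matrix k → Set
A ≋ B = ∀ i j → A i j ≈ B i j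

_·_ : ∀ {k} → Matrix k → Matrix k → Matrix k
(A · B) i j = sumᶜ (λ l → A i l *ᶜ B l j)

𝟙 : ∀ {k} → Matrix k
𝟙 i j with i Fin.≟ j
... | yes _ = 1ᶜ
... | no  _ = 0ᶜ

record Invertible {k} (A : Matrix k) : Set where
  field
    inverse  : Matrix k
    inverseˡ : inverse · A ≋ 𝟙
    inverseʳ : A · inverse ≋ 𝟙

open Invertible public

‖_‖ : ∀ {k} → Matrix k → ℝ
‖ A ‖ = √ (sumᵣ (λ i → sumᵣ (λ j → ∣ A i j ∣²)))

-- The inverse is unique up to _≋_, so the value does not depend on the
-- choice of the second argument.
Cond : ∀ {k} (A : Matrix k) → Invertible A → ℝ
Cond A A-inv = ‖ A ‖ *ᵣ ‖ inverse A-inv ‖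

IsPrimitiveRoot : ℕ → ℂ → Set
IsPrimitiveRoot n z = z ^ n ≈ 1ᶜ × (∀ k → 0 ℕ.< k → k ℕ.< n → ¬ (z ^ k ≈ 1ᶜ))

record ListsPrimitiveRoots (n : ℕ) (ζ : Fin (φ n) → ℂ) : Set where
  field
    arePrimitive : ∀ i → IsPrimitiveRoot n (ζ i)
    distinct     : ∀ i j → ζ i ≈ ζ j → i ≡ j
    complete     : ∀ z → IsPrimitiveRoot n z → ∃[ i ] z ≈ ζ i

-- The exponent is j rather than j - 1 because Fin counts from 0.
vandermonde : ∀ {k} → (Fin k → ℂ) → Matrix k
vandermonde ζ i j = ζ i ^ toℕ j

-- Put r = rad n and n = q r. The qth power maps the primitive nth roots of
-- unity onto the primitive rth roots, with all fibres of size q, and the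
-- inverse W of V_n can be written down from the inverse U of V_r: with
-- ξ_a = ζᵢ^q and j = q b + c (0 ≤ c < q), W (j, i) = ζᵢ⁻ᶜ U (b, a) / q, because
-- the sum of (ζᵢ / ζᵢ′)ᶜ over c vanishes for distinct ζᵢ, ζᵢ′ in one fibre.
-- Roots of unity having modulus 1, ‖W‖ = ‖U‖, while ‖V_n‖ = φ(n) = q φ(r) = q ‖V_r‖.
--
-- Equality of roots of unity is decidable although that of complex numbers
-- is not: if yⁿ = 1, then (1 + y + … + yⁿ⁻¹) / n is idempotent, hence 0 or 1,
-- and it is 1 only if y = 1. If it is 0, then 1 - y is moreover invertible,
-- as (1 - y) ∑ₖ (1 + y + … + yᵏ⁻¹) = n.

module Submission where

open import Algebra.Bundles using (CommutativeRing)
import Algebra.Properties.CommutativeMonoid.Sum as CMSum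
import Algebra.Properties.CommutativeSemiring.Exp as Exp
import Algebra.Properties.Ring as RingProps
import Algebra.Properties.Semiring.Exp as SExp
import Algebra.Properties.Semiring.Mult as Mult
import Algebra.Properties.Semiring.Sum as SSum
import Algebra.Solver.Ring.NaturalCoefficients.Default as NatSolver
open import Data.Fin.Base as Fin using (Fin; toℕ; zero; suc; combine; remQuot; _↑ˡ_; _↑ʳ_)
import Data.Fin.Properties as Fin
open import Data.Fin.Permutation using (Permutation; permutation; ↔⇒≡; _⟨$⟩ʳ_)
open import Data.Integer.Base using (+_)
open import Data.List.Base using ([]; _∷_; map; upTo)
open import Data.List.Membership.Propositional.Properties using (∈-filter⁺; ∈-upTo⁺)
open import Data.List.Relation.Unary.All as All using (All; []; _∷_)
import Data.List.Relation.Unary.All.Properties as All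
open import Data.List.Relation.Unary.AllPairs using ([]; _∷_)
open import Data.List.Relation.Unary.Any as Any using (here)
open import Data.List.Relation.Unary.Unique.Propositional using (Unique)
import Data.List.Relation.Unary.Unique.Propositional.Properties as Unique
open import Data.Nat.Base as ℕ using (ℕ; zero; suc; NonZero; pred)
import Data.Nat.Properties as ℕ
open import Data.Nat.Coprimality using (coprime?; 1-coprimeTo)
open import Data.Nat.Divisibility using (_∣_; divides; _∣?_; *-monoˡ-∣; ∣⇒≤; 1∣_; m∣m*n)
open import Data.Nat.GCD using (module GCD; module Bézout)
open import Data.Nat.ListAction using (product)
open import Data.Nat.ListAction.Properties using (∈⇒∣product)
open import Data.Nat.Primality
  using (Prime; prime?; euclidsLemma; prime⇒nonZero; prime⇒nonTrivial)
open import Data.Nat.Primality.Factorisation using (factorise; factorisationHasAllPrimeFactors)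
open import Data.Product.Base using (Σ-syntax; ∃-syntax; _×_; _,_; proj₁; proj₂; uncurry)
open import Data.Rational.Base as ℚ using (ℚ; 0ℚ; 1ℚ; ½; ∣_∣; _/_)
import Data.Rational.Properties as ℚ
open import Data.Rational.Solver using (module +-*-Solver)
open import Data.Sum.Base as Sum using (_⊎_; inj₁; inj₂)
open import Function.Base using (_∘_; _⟨_⟩_)
open import Level using (0ℓ; _⊔_)
open import Relation.Binary.Definitions using (tri<; tri≈; tri>)
open import Relation.Binary.PropositionalEquality as ≡ using (_≡_; _≢_)
open import Relation.Nullary.Decidable using (Dec; yes; no; _×-dec_)
open import Relation.Nullary.Negation using (¬_; contradiction)

-- The radical enters at one point: x is a primitive nth root as soon as x^q is a primitive rth
-- root, because every prime dividing n = q r already divides r. The fibres are found algebraically.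
-- As φ(n) ≥ 1, the list contains some primitive root z; then z^q and w = zʳ are primitive of orders
-- r and q, and orthogonality of characters makes every rth root of unity a power of z^q and every
-- qth root of unity a power of w. So ξ_a = z^(q t) for some t, and the fibre over ξ_a consists of
-- the products zᵗ wˢ with 0 ≤ s < q. To invert V_n, the differences of the nodes must be units,
-- which mere distinctness does not give constructively; this is what forces the detour through
-- idempotents. Those of ℝ are decided by inspecting a single term far out in a Cauchy sequence, and
-- those of ℂ turn out to be real. The algebra is therefore done over any commutative ring with
-- trivial idempotents in which positive integers are invertible, and inequalities between rationals
-- serve only for idempotents, moduli and square roots.

-- Products of distinct primes and proper divisors

-- Euclid's lemma: if n = t * `product ps`, then p divides t or `product ps`, and in the second case
-- p would occur in `ps`, against uniqueness.
product-distinct-primes-∣ : ∀ {n ps} → Unique ps → All Prime ps → All (_∣ n) ps → product ps ∣ n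
product-distinct-primes-∣ []         []         []         = 1∣ _
product-distinct-primes-∣ {ps = p ∷ ps} (p∉ps ∷ u) (pr ∷ prs) (p∣n ∷ ds)
  with divides t ≡.refl ← product-distinct-primes-∣ u prs ds
  with euclidsLemma t (product ps) pr p∣n
... | inj₁ p∣t   = *-monoˡ-∣ (product ps) p∣t
... | inj₂ p∣Πps = contradiction ≡.refl (All.lookup p∉ps (factorisationHasAllPrimeFactors pr p∣Πps prs))

∃-prime-divisor : ∀ n .{{_ : NonZero n}} → n ≢ 1 → ∃[ p ] Prime p × p ∣ n
∃-prime-divisor n n≢1 with factorise n
... | record { factors = [] ; isFactorisation = n≡1 } = contradiction n≡1 n≢1
... | record { factors = p ∷ ps ; isFactorisation = n≡Π ; factorsPrime = pr ∷ _ } =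
  p , pr , ≡.subst (p ∣_) (≡.sym n≡Π) (m∣m*n (product ps))

-- Write q r = e d with e ≠ 1 and take a prime p dividing e. It divides r by hypothesis, and h = r /
-- p works, since q h = (q r) / p = (e / p) d.
proper-divisor-descends : ∀ q r .{{_ : NonZero q}} .{{_ : NonZero r}} →
  (∀ {p} → Prime p → p ∣ q ℕ.* r → p ∣ r) → ∀ {d} → d ∣ q ℕ.* r → d ℕ.< q ℕ.* r →
  ∃[ h ] 0 ℕ.< h × h ℕ.< r × d ∣ q ℕ.* h
proper-divisor-descends q r primes {d} (divides e n≡e*d) d<n =
  let p , pr , divides f e≡f*p = ∃-prime-divisor e {{e-nonZero}} e≢1
      n≡f*d*p = ≡.trans n≡e*d (≡.trans (≡.cong (ℕ._* d) e≡f*p) (swap f p d))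
      divides h r≡h*p = primes pr (divides (f ℕ.* d) n≡f*d*p)
      h-nonZero = ℕ.≢-nonZero λ h≡0 → ℕ.≢-nonZero⁻¹ r (≡.trans r≡h*p (≡.cong (ℕ._* p) h≡0))
  in h , ℕ.>-nonZero⁻¹ h {{h-nonZero}}
   , ≡.subst (h ℕ.<_) (≡.sym r≡h*p) (ℕ.m<m*n h p {{h-nonZero}} (ℕ.nonTrivial⇒n>1 p {{prime⇒nonTrivial pr}}))
   , divides f (ℕ.*-cancelʳ-≡ (q ℕ.* h) (f ℕ.* d) p {{prime⇒nonZero pr}}
       (≡.trans (ℕ.*-assoc q h p) (≡.trans (≡.cong (q ℕ.*_) (≡.sym r≡h*p)) n≡f*d*p)))
  where
  swap : ∀ a b c → a ℕ.* b ℕ.* c ≡ a ℕ.* c ℕ.* b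
  swap a b c = ≡.trans (ℕ.*-assoc a b c)
    (≡.trans (≡.cong (a ℕ.*_) (ℕ.*-comm b c)) (≡.sym (ℕ.*-assoc a c b)))
  e-nonZero : NonZero e
  e-nonZero = ℕ.≢-nonZero λ e≡0 → ℕ.≢-nonZero⁻¹ (q ℕ.* r) {{ℕ.m*n≢0 q r}}
    (≡.trans n≡e*d (≡.cong (ℕ._* d) e≡0))
  e≢1 : e ≢ 1
  e≢1 e≡1 = ℕ.<⇒≢ d<n (≡.sym (≡.trans n≡e*d (≡.trans (≡.cong (ℕ._* d) e≡1) (ℕ.*-identityˡ d))))

-- Linear algebra of Vandermonde matrices over a commutative ring

module RingTheory {c ℓ} (C : CommutativeRing c ℓ) where

  open CommutativeRing C hiding (zero)
  open CMSum +-commutativeMonoid public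
  open SExp semiring public
  open Exp commutativeSemiring public using (^-distrib-*)
  open Mult semiring public
    using (×-assoc-*; ×-congʳ; ×1-homo-*) renaming (_×_ to _⨯_)
  open RingProps ring public using (-‿distribˡ-*; -0#≈0#; x∙y⁻¹≈ε⇒x≈y; +-cancelˡ; +-cancelʳ)
  open NatSolver commutativeSemiring
  open import Relation.Binary.Reasoning.Setoid setoid

  sum-cong : ∀ n {f g : Fin n → Carrier} → (∀ i → f i ≈ g i) → sum f ≈ sum g
  sum-cong n = sum-cong-≋ {n}

  sum-zero : ∀ n {f : Fin n → Carrier} → (∀ i → f i ≈ 0#) → sum f ≈ 0#
  sum-zero n eq = trans (sum-cong n eq) (sum-replicate-zero n)

  sum-const : ∀ n {f : Fin n → Carrier} x → (∀ i → f i ≈ x) → sum f ≈ n ⨯ x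
  sum-const n x eq = trans (sum-cong n eq) (sum-replicate n)

  *-sumˡ : ∀ n x (f : Fin n → Carrier) → x * sum f ≈ sum (λ i → x * f i)
  *-sumˡ n x f = SSum.*-distribˡ-sum semiring {n} x f

  *-sumʳ : ∀ n x (f : Fin n → Carrier) → sum f * x ≈ sum (λ i → f i * x)
  *-sumʳ n x f = SSum.*-distribʳ-sum semiring {n} x f

  sum-single : ∀ {n} (f : Fin n → Carrier) i → (∀ j → j ≢ i → f j ≈ 0#) → sum f ≈ f i
  sum-single {suc n} f zero    eq = trans (+-congˡ (sum-zero n (λ j → eq (suc j) λ ()))) (+-identityʳ _)
  sum-single f (suc i) eq = trans (+-congʳ (eq zero λ ())) (trans (+-identityˡ _)
    (sum-single (f ∘ suc) i (λ j j≢i → eq (suc j) (j≢i ∘ Fin.suc-injective))))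

  sum-++ : ∀ m {n} (f : Fin (m ℕ.+ n) → Carrier) →
    sum f ≈ sum (λ i → f (i ↑ˡ n)) + sum (λ j → f (m ↑ʳ j))
  sum-++ zero    f = sym (+-identityˡ _)
  sum-++ (suc m) f = trans (+-congˡ (sum-++ m (f ∘ suc))) (sym (+-assoc _ _ _))

  sum-combine : ∀ m {n} (f : Fin (m ℕ.* n) → Carrier) →
    sum f ≈ sum {m} (λ i → sum {n} (λ j → f (combine i j)))
  sum-combine zero        f = refl
  sum-combine (suc m) {n} f = trans (sum-++ n f) (+-congˡ (sum-combine m (f ∘ (n ↑ʳ_))))

  1^ : ∀ n → 1# ^ n ≈ 1#
  1^ zero    = refl
  1^ (suc n) = trans (*-identityˡ _) (1^ n)

  -- Polynomials are given by their coefficients, lowest degree first.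

  eval : ∀ {k} → (Fin k → Carrier) → Carrier → Carrier
  eval c x = sum (λ j → x ^ toℕ j * c j)

  eval-suc : ∀ {k} (c : Fin (suc k) → Carrier) x → eval c x ≈ c zero + x * eval (c ∘ suc) x
  eval-suc {k} c x = +-cong (*-identityˡ _)
    (trans (sum-cong k (λ j → *-assoc x _ _)) (sym (*-sumˡ k x _)))

  -- The coefficients of f + (x + y) d(x).
  shift : ∀ {k} (y f : Carrier) → (Fin k → Carrier) → Fin (suc k) → Carrier
  shift {zero}  y f d _       = f
  shift {suc k} y f d zero    = f + y * d zero
  shift {suc k} y f d (suc j) = shift y (d zero) (d ∘ suc) j

  eval-shift : ∀ {k} y f (d : Fin k → Carrier) x →
    eval (shift y f d) x ≈ f + (x + y) * eval d x
  eval-shift {zero}  y f d x = +-cong (*-identityˡ f) (sym (zeroʳ (x + y)))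
  eval-shift {suc k} y f d x = begin
    eval (shift y f d) x
      ≈⟨ eval-suc (shift y f d) x ⟩
    (f + y * d zero) + x * eval (shift y (d zero) (d ∘ suc)) x
      ≈⟨ +-congˡ (*-congˡ (eval-shift y (d zero) (d ∘ suc) x)) ⟩
    (f + y * d zero) + x * (d zero + (x + y) * eval (d ∘ suc) x)
      ≈⟨ solve 5 (λ f y d x e → (f :+ y :* d) :+ x :* (d :+ (x :+ y) :* e)
           := f :+ (x :+ y) :* (d :+ x :* e)) refl f y (d zero) x (eval (d ∘ suc) x) ⟩
    f + (x + y) * (d zero + x * eval (d ∘ suc) x)
      ≈⟨ +-congˡ (*-congˡ (eval-suc d x)) ⟨
    f + (x + y) * eval d x ∎

  -- The coefficients of (c(x) - c(a)) / (x - a).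
  quotient : ∀ {k} (a : Carrier) → (Fin (suc k) → Carrier) → Fin k → Carrier
  quotient {suc k} a c zero    = eval (c ∘ suc) a
  quotient {suc k} a c (suc j) = quotient a (c ∘ suc) j

  -- This is c(x) - c(a) = (x - a) Q(x), arranged without subtraction so that the semiring solver
  -- applies. The coefficients of Q are those of Horner's scheme at a.
  eval-quotient : ∀ {k} a (c : Fin (suc k) → Carrier) x →
    eval c x + a * eval (quotient a c) x ≈ eval c a + x * eval (quotient a c) x
  eval-quotient {zero}  a c x = +-congˡ (trans (zeroʳ a) (sym (zeroʳ x)))
  eval-quotient {suc k} a c x = begin
    eval c x + a * eval (quotient a c) x
      ≈⟨ +-cong (eval-suc c x) (*-congˡ (eval-suc (quotient a c) x)) ⟩
    (c zero + x * t) + a * (τ + x * d)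
      ≈⟨ solve 6 (λ c x t a τ d → (c :+ x :* t) :+ a :* (τ :+ x :* d)
           := (c :+ a :* τ) :+ x :* (t :+ a :* d)) refl (c zero) x t a τ d ⟩
    (c zero + a * τ) + x * (t + a * d)
      ≈⟨ +-congˡ (*-congˡ (eval-quotient a (c ∘ suc) x)) ⟩
    (c zero + a * τ) + x * (τ + x * d)
      ≈⟨ +-cong (eval-suc c a) (*-congˡ (eval-suc (quotient a c) x)) ⟨
    eval c a + x * eval (quotient a c) x ∎
    where
    t τ d : Carrier
    t = eval (c ∘ suc) x
    τ = eval (c ∘ suc) a
    d = eval (quotient a (c ∘ suc)) x

  -- The first coefficient of the quotient is the value at a of the tail of c, so both hypotheses
  -- pass to the tail; the constant term is then all that remains of c(a).
  quotient-zero : ∀ {k} a (c : Fin (suc k) → Carrier) → eval c a ≈ 0# →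
    (∀ j → quotient a c j ≈ 0#) → ∀ j → c j ≈ 0#
  quotient-zero {zero}  a c eq q≈0 zero = trans (sym (trans (+-identityʳ _) (*-identityˡ _))) eq
  quotient-zero {suc k} a c eq q≈0 (suc j) =
    quotient-zero a (c ∘ suc) (q≈0 zero) (q≈0 ∘ suc) j
  quotient-zero {suc k} a c eq q≈0 zero = begin
    c zero                          ≈⟨ +-identityʳ _ ⟨
    c zero + 0#                     ≈⟨ +-congˡ (trans (*-congˡ (q≈0 zero)) (zeroʳ a)) ⟨
    c zero + a * eval (c ∘ suc) a   ≈⟨ eval-suc c a ⟨
    eval c a                        ≈⟨ eq ⟩
    0#                              ∎

  -- Differences are asked to be units, because in a general commutative ring distinctness of the
  -- nodes provides no inverse.
  Separated : ∀ {k} → (Fin k → Carrier) → Set _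
  Separated x = ∀ i j → i ≢ j → ∃[ u ] (x i - x j) * u ≈ 1#

  tail-separated : ∀ {k} {x : Fin (suc k) → Carrier} → Separated x → Separated (x ∘ suc)
  tail-separated sep i j i≢j = sep (suc i) (suc j) (i≢j ∘ Fin.suc-injective)

  -- Newton's scheme: c(x) = f₀ + (x - x₀) d(x), where d interpolates the divided differences (fᵢ -
  -- f₀) / (xᵢ - x₀) at the remaining nodes.
  interpolate : ∀ {k} (x : Fin k → Carrier) → Separated x → (f : Fin k → Carrier) →
    Σ[ c ∈ (Fin k → Carrier) ] (∀ i → eval c (x i) ≈ f i)
  interpolate {zero}  x sep f = (λ ()) , λ ()
  interpolate {suc k} x sep f = shift (- x zero) (f zero) (proj₁ rec) , λ i →
    trans (eval-shift (- x zero) (f zero) (proj₁ rec) (x i)) (values i)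
    where
    u : Fin k → Carrier
    u i = proj₁ (sep (suc i) zero λ ())
    rec : Σ[ d ∈ (Fin k → Carrier) ] (∀ i → eval d (x (suc i)) ≈ u i * (f (suc i) - f zero))
    rec = interpolate (x ∘ suc) (tail-separated {x = x} sep) (λ i → u i * (f (suc i) - f zero))
    values : ∀ i → f zero + (x i - x zero) * eval (proj₁ rec) (x i) ≈ f i
    values zero    = trans (+-congˡ (trans (*-congʳ (-‿inverseʳ (x zero))) (zeroˡ _))) (+-identityʳ _)
    values (suc i) = begin
      f zero + (x (suc i) - x zero) * eval (proj₁ rec) (x (suc i))
        ≈⟨ +-congˡ (*-congˡ (proj₂ rec i)) ⟩
      f zero + (x (suc i) - x zero) * (u i * (f (suc i) - f zero))
        ≈⟨ +-congˡ (trans (sym (*-assoc _ _ _)) (*-congʳ (proj₂ (sep (suc i) zero λ ())))) ⟩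
      f zero + 1# * (f (suc i) - f zero)
        ≈⟨ solve 3 (λ a b c → a :+ con 1 :* (b :+ c) := b :+ (a :+ c)) refl (f zero) (f (suc i)) (- f zero) ⟩
      f (suc i) + (f zero - f zero)
        ≈⟨ trans (+-congˡ (-‿inverseʳ (f zero))) (+-identityʳ _) ⟩
      f (suc i) ∎

  -- Dividing by x - x₀ leaves a polynomial with one coefficient less; it vanishes at the other
  -- nodes because xᵢ - x₀ is a unit, so induction applies to it.
  eval-injective₀ : ∀ {k} (x : Fin k → Carrier) → Separated x → (c : Fin k → Carrier) →
    (∀ i → eval c (x i) ≈ 0#) → ∀ j → c j ≈ 0#
  eval-injective₀ {zero}  x sep c eq ()
  eval-injective₀ {suc k} x sep c eq = quotient-zero (x zero) c (eq zero)
    (eval-injective₀ (x ∘ suc) (tail-separated {x = x} sep) d vanishes)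
    where
    d : Fin k → Carrier
    d = quotient (x zero) c
    vanishes : ∀ i → eval d (x (suc i)) ≈ 0#
    vanishes i = begin
      e                                  ≈⟨ *-identityˡ e ⟨
      1# * e                             ≈⟨ *-congʳ (proj₂ unit) ⟨
      ((xᵢ - x zero) * u) * e
        ≈⟨ solve 4 (λ a b u e → ((a :+ b) :* u) :* e := u :* (a :* e :+ b :* e))
             refl xᵢ (- x zero) u e ⟩
      u * (xᵢ * e + - x zero * e)        ≈⟨ *-congˡ (+-congʳ (sym flip)) ⟩
      u * (x zero * e + - x zero * e)    ≈⟨ *-congˡ (distribʳ e (x zero) (- x zero)) ⟨
      u * ((x zero - x zero) * e)        ≈⟨ *-congˡ (trans (*-congʳ (-‿inverseʳ (x zero))) (zeroˡ e)) ⟩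
      u * 0#                             ≈⟨ zeroʳ u ⟩
      0#                                 ∎
      where
      xᵢ e u : Carrier
      xᵢ = x (suc i)
      e = eval d xᵢ
      unit : ∃[ u ] (xᵢ - x zero) * u ≈ 1#
      unit = sep (suc i) zero λ ()
      u = proj₁ unit
      flip : x zero * e ≈ xᵢ * e
      flip = begin
        x zero * e                 ≈⟨ +-identityˡ _ ⟨
        0# + x zero * e            ≈⟨ +-congʳ (eq (suc i)) ⟨
        eval c xᵢ + x zero * e     ≈⟨ eval-quotient (x zero) c xᵢ ⟩
        eval c (x zero) + xᵢ * e   ≈⟨ +-congʳ (eq zero) ⟩
        0# + xᵢ * e                ≈⟨ +-identityˡ _ ⟩
        xᵢ * e                     ∎

  eval-injective : ∀ {k} (x : Fin k → Carrier) → Separated x → (c d : Fin k → Carrier) →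
    (∀ i → eval c (x i) ≈ eval d (x i)) → ∀ j → c j ≈ d j
  eval-injective {k} x sep c d eq j = x∙y⁻¹≈ε⇒x≈y (c j) (d j)
    (eval-injective₀ x sep (λ j → c j - d j) vanishes j)
    where
    vanishes : ∀ i → eval (λ j → c j - d j) (x i) ≈ 0#
    vanishes i = +-cancelʳ (eval d (x i)) _ _ (begin
      eval (λ j → c j - d j) (x i) + eval d (x i)
        ≈⟨ ∑-distrib-+ {k} (λ j → x i ^ toℕ j * (c j - d j)) _ ⟨
      sum (λ j → x i ^ toℕ j * (c j - d j) + x i ^ toℕ j * d j)
        ≈⟨ sum-cong k (λ j → trans (sym (distribˡ _ _ _)) (*-congˡ
             (trans (+-assoc _ _ _) (trans (+-congˡ (-‿inverseˡ (d j))) (+-identityʳ _))))) ⟩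
      eval c (x i)         ≈⟨ eq i ⟩
      eval d (x i)         ≈⟨ +-identityˡ _ ⟨
      0# + eval d (x i)    ∎)

  -- A right inverse of a square Vandermonde matrix is a left inverse: both
  -- W V and 1 are mapped to V by the injective map V.
  right⇒leftInverse : ∀ {k} (x : Fin k → Carrier) → Separated x →
    (W δ : Fin k → Fin k → Carrier) → (∀ i → δ i i ≈ 1#) → (∀ i j → i ≢ j → δ i j ≈ 0#) →
    (∀ i j → eval (λ l → W l j) (x i) ≈ δ i j) →
    ∀ i j → sum (λ l → W i l * x l ^ toℕ j) ≈ δ i j
  right⇒leftInverse {k} x sep W δ diag off VW i j =
    eval-injective x sep (λ i → sum (λ l → W i l * x l ^ toℕ j)) (λ i → δ i j) agree i
    where
    agree : ∀ i → eval (λ h → sum (λ l → W h l * x l ^ toℕ j)) (x i) ≈ eval (λ h → δ h j) (x i)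
    agree i = begin
      sum (λ h → x i ^ toℕ h * sum (λ l → W h l * x l ^ toℕ j))
        ≈⟨ sum-cong k (λ h → trans (*-sumˡ k (x i ^ toℕ h) _)
             (sum-cong k (λ l → sym (*-assoc (x i ^ toℕ h) (W h l) (x l ^ toℕ j))))) ⟩
      sum (λ h → sum (λ l → x i ^ toℕ h * W h l * x l ^ toℕ j))
        ≈⟨ ∑-comm {k} {k} (λ h l → x i ^ toℕ h * W h l * x l ^ toℕ j) ⟩
      sum (λ l → sum (λ h → x i ^ toℕ h * W h l * x l ^ toℕ j))
        ≈⟨ sum-cong k (λ l → trans (sym (*-sumʳ k (x l ^ toℕ j) _)) (*-congʳ (VW i l))) ⟩
      sum (λ l → δ i l * x l ^ toℕ j)
        ≈⟨ sum-single _ i (λ l l≢i → trans (*-congʳ (off i l (l≢i ∘ ≡.sym))) (zeroˡ _)) ⟩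
      δ i i * x i ^ toℕ j
        ≈⟨ trans (*-congʳ (diag i)) (*-identityˡ _) ⟩
      x i ^ toℕ j
        ≈⟨ trans (*-congˡ (diag j)) (*-identityʳ _) ⟨
      x i ^ toℕ j * δ j j
        ≈⟨ sum-single _ j (λ h h≢j → trans (*-congˡ (off h j h≢j)) (zeroʳ _)) ⟨
      sum (λ h → x i ^ toℕ h * δ h j) ∎

  -- Geometric sums

  geometric : ℕ → Carrier → Carrier
  geometric n w = sum {n} (λ k → w ^ toℕ k)

  geometric-suc : ∀ n w → geometric (suc n) w ≈ 1# + w * geometric n w
  geometric-suc n w = +-congˡ (sym (*-sumˡ n w _))

  geometric-1 : ∀ n {w} → w ≈ 1# → geometric n w ≈ n ⨯ 1#
  geometric-1 n w≈1 = sum-const n 1# (λ k → trans (^-congˡ (toℕ k) w≈1) (1^ (toℕ k)))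

  geometric-last : ∀ n w → geometric (suc n) w ≈ geometric n w + w ^ n
  geometric-last zero    w = trans (+-identityʳ _) (sym (+-identityˡ _))
  geometric-last (suc n) w = begin
    geometric (suc (suc n)) w            ≈⟨ geometric-suc (suc n) w ⟩
    1# + w * geometric (suc n) w         ≈⟨ +-congˡ (*-congˡ (geometric-last n w)) ⟩
    1# + w * (geometric n w + w ^ n)     ≈⟨ trans (+-congˡ (distribˡ w _ _)) (sym (+-assoc _ _ _)) ⟩
    (1# + w * geometric n w) + w ^ suc n ≈⟨ +-congʳ (geometric-suc n w) ⟨
    geometric (suc n) w + w ^ suc n      ∎

  -- Splitting off the first or the last term of 1 + w + ... + wⁿ gives 1 + w S = S + wⁿ.
  geometric-fixed : ∀ n {w} → w ^ n ≈ 1# → w * geometric n w ≈ geometric n w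
  geometric-fixed n {w} wⁿ≈1 = +-cancelˡ 1# _ _ (begin
    1# + w * geometric n w   ≈⟨ geometric-suc n w ⟨
    geometric (suc n) w      ≈⟨ geometric-last n w ⟩
    geometric n w + w ^ n    ≈⟨ trans (+-congˡ wⁿ≈1) (+-comm _ _) ⟩
    1# + geometric n w       ∎)

  ^-fixed : ∀ {w s} → w * s ≈ s → ∀ k → w ^ k * s ≈ s
  ^-fixed fix zero    = *-identityˡ _
  ^-fixed fix (suc k) = trans (*-assoc _ _ _) (trans (*-congˡ (^-fixed fix k)) fix)

  -- Multiplication by w fixes S, hence so does each wᵏ, and S * S is a sum of n copies of S.
  geometric-square : ∀ n {w} → w ^ n ≈ 1# →
    geometric n w * geometric n w ≈ n ⨯ 1# * geometric n w
  geometric-square n {w} wⁿ≈1 = begin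
    geometric n w * geometric n w                    ≈⟨ *-sumʳ n _ _ ⟩
    sum {n} (λ k → w ^ toℕ k * geometric n w)
      ≈⟨ sum-const n (geometric n w) (λ k → ^-fixed (geometric-fixed n wⁿ≈1) (toℕ k)) ⟩
    n ⨯ geometric n w
      ≈⟨ trans (×-assoc-* n 1# (geometric n w)) (×-congʳ n (*-identityˡ _)) ⟨
    n ⨯ 1# * geometric n w ∎

  geometric² : ℕ → Carrier → Carrier
  geometric² zero    w = 0#
  geometric² (suc n) w = geometric² n w + geometric n w

  -- With gₖ = 1 + ... + wᵏ⁻¹, sum 1 + w gₖ = gₖ₊₁ over k < n; since g₀ = 0, the right-hand sides
  -- add up to gₙ plus the sum of the gₖ.
  geometric²-identity : ∀ n w → n ⨯ 1# + w * geometric² n w ≈ geometric n w + geometric² n w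
  geometric²-identity zero    w = +-congˡ (zeroʳ w)
  geometric²-identity (suc n) w = begin
    (1# + N) + w * (T + S)
      ≈⟨ solve 5 (λ o N w T S → (o :+ N) :+ w :* (T :+ S) := o :+ w :* S :+ (N :+ w :* T))
           refl 1# N w T S ⟩
    (1# + w * S) + (N + w * T) ≈⟨ +-congˡ (geometric²-identity n w) ⟩
    (1# + w * S) + (S + T)     ≈⟨ +-cong (sym (geometric-suc n w)) (+-comm S T) ⟩
    geometric (suc n) w + (T + S) ∎
    where
    N S T : Carrier
    N = n ⨯ 1#
    S = geometric n w
    T = geometric² n w

  geometric≈0⇒unit : ∀ n {w} → geometric n w ≈ 0# → (1# - w) * geometric² n w ≈ n ⨯ 1#
  geometric≈0⇒unit n {w} S≈0 = +-cancelʳ (w * T) _ _ (begin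
    (1# - w) * T + w * T  ≈⟨ distribʳ T _ _ ⟨
    (1# - w + w) * T      ≈⟨ *-congʳ (trans (+-assoc _ _ _) (trans (+-congˡ (-‿inverseˡ w)) (+-identityʳ 1#))) ⟩
    1# * T                ≈⟨ trans (*-identityˡ T) (sym (+-identityˡ T)) ⟩
    0# + T                ≈⟨ +-congʳ S≈0 ⟨
    geometric n w + T     ≈⟨ geometric²-identity n w ⟨
    n ⨯ 1# + w * T        ∎)
    where
    T : Carrier
    T = geometric² n w

  -- Here e = a + b i, with e² = e read off componentwise; both summands of
  -- the conclusion are squares.
  idempotent-imaginary : ∀ a b → a * a - b * b ≈ a → a * b + b * a ≈ b →
    b * b + (b * b + b * b) * (b * b + b * b) ≈ 0#
  idempotent-imaginary a b re≈ im≈ = sym (+-cancelˡ (b * b) _ _ (begin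
    b * b + 0#                                 ≈⟨ +-identityʳ _ ⟩
    b * b                                      ≈⟨ *-cong im≈ im≈ ⟨
    (a * b + b * a) * (a * b + b * a)
      ≈⟨ solve 2 (λ a b → (a :* b :+ b :* a) :* (a :* b :+ b :* a) :=
           (a :* a :+ a :* a) :* (b :* b :+ b :* b)) refl a b ⟩
    (a * a + a * a) * (b * b + b * b)                 ≈⟨ *-congʳ (+-cong a²≈a+b² a²≈a+b²) ⟩
    ((a + b * b) + (a + b * b)) * (b * b + b * b)
      ≈⟨ solve 2 (λ a b → ((a :+ b :* b) :+ (a :+ b :* b)) :* (b :* b :+ b :* b) :=
           (a :* b :+ b :* a) :* b :+ ((a :* b :+ b :* a) :* b :+
             (b :* b :+ b :* b) :* (b :* b :+ b :* b))) refl a b ⟩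
    (a * b + b * a) * b + ((a * b + b * a) * b + (b * b + b * b) * (b * b + b * b))
      ≈⟨ +-cong (*-congʳ im≈) (+-congʳ (*-congʳ im≈)) ⟩
    b * b + (b * b + (b * b + b * b) * (b * b + b * b)) ∎))
    where
    a²≈a+b² : a * a ≈ a + b * b
    a²≈a+b² = begin
      a * a                      ≈⟨ +-identityʳ _ ⟨
      a * a + 0#                 ≈⟨ +-congˡ (-‿inverseˡ (b * b)) ⟨
      a * a + (- (b * b) + b * b) ≈⟨ +-assoc _ _ _ ⟨
      a * a - b * b + b * b      ≈⟨ +-congʳ re≈ ⟩
      a + b * b                  ∎

  square-from-difference : ∀ {a b} → b ≈ 0# → a * a - b * b ≈ a → a * a ≈ a
  square-from-difference {a} {b} b≈0 eq = begin
    a * a           ≈⟨ +-identityʳ _ ⟨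
    a * a + 0#      ≈⟨ +-congˡ -0#≈0# ⟨
    a * a - 0#      ≈⟨ +-congˡ (-‿cong (trans (*-congʳ b≈0) (zeroˡ b))) ⟨
    a * a - b * b   ≈⟨ eq ⟩
    a               ∎

  -- The shape of the final computation: a and a′ are the norms of the two Vandermonde matrices, m
  -- and m′ their orders, b and b′ the norms of the inverses, and k is q.
  proportional : ∀ {a a′ b b′ k m m′} → a ≈ m → a′ ≈ m′ → b ≈ b′ → m ≈ m′ * k →
    a * b ≈ k * (a′ * b′)
  proportional {a} {a′} {b} {b′} {k} {m} {m′} a≈m a′≈m′ b≈b′ m≈m′k = begin
    a * b            ≈⟨ *-cong (trans a≈m m≈m′k) b≈b′ ⟩
    (m′ * k) * b′    ≈⟨ *-congʳ (*-congʳ a′≈m′) ⟨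
    (a′ * k) * b′    ≈⟨ solve 3 (λ a k b → (a :* k) :* b := k :* (a :* b)) refl a′ k b′ ⟩
    k * (a′ * b′)    ∎

  ⨯≈⨯1* : ∀ n x → n ⨯ x ≈ (n ⨯ 1#) * x
  ⨯≈⨯1* n x = sym (trans (×-assoc-* n 1# x) (×-congʳ n (*-identityˡ x)))

  double-sum-const : ∀ m n {f : Fin m → Fin n → Carrier} x → (∀ i j → f i j ≈ x) →
    sum {m} (λ i → sum {n} (f i)) ≈ (m ⨯ 1#) * ((n ⨯ 1#) * x)
  double-sum-const m n x eq = trans
    (sum-const m ((n ⨯ 1#) * x) (λ i → trans (sum-const n x (eq i)) (⨯≈⨯1* n x)))
    (⨯≈⨯1* m ((n ⨯ 1#) * x))

  -- Connected refers to the spectrum: there are no idempotents but 0 and 1. These properties stand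
  -- in for the field axioms.
  record IsConnectedℚAlgebra : Set (c ⊔ ℓ) where
    field
      1≉0        : ¬ (1# ≈ 0#)
      reciprocal : ∀ n .{{_ : NonZero n}} → ∃[ κ ] κ * (n ⨯ 1#) ≈ 1#
      idempotent : ∀ e → e * e ≈ e → e ≈ 0# ⊎ e ≈ 1#

module _ {c ℓ c′ ℓ′} (C : CommutativeRing c ℓ) (R : CommutativeRing c′ ℓ′) where
  private
    module C = CommutativeRing C
    module R = CommutativeRing R
    module CT = RingTheory C
    module RT = RingTheory R

  multiplicative-^ : (N : C.Carrier → R.Carrier) → N C.1# R.≈ R.1# →
    (∀ x y → N (x C.* y) R.≈ N x R.* N y) → ∀ x n → N (x CT.^ n) R.≈ N x RT.^ n
  multiplicative-^ N N1≈1 N-* x zero    = N1≈1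
  multiplicative-^ N N1≈1 N-* x (suc n) =
    R.trans (N-* x (x CT.^ n)) (R.*-congˡ (multiplicative-^ N N1≈1 N-* x n))

  -- The squared modulus is polynomial in the real and imaginary parts, so square roots are
  -- postponed to the norms themselves. The field `∣∣²-⨯` serves to evaluate the squared modulus of
  -- 1 / q.
  record SquaredModulus : Set (c ⊔ ℓ ⊔ c′ ⊔ ℓ′) where
    field
      ∣_∣²     : C.Carrier → R.Carrier
      ∣∣²-cong : ∀ {x y} → x C.≈ y → ∣ x ∣² R.≈ ∣ y ∣²
      ∣∣²-*    : ∀ x y → ∣ x C.* y ∣² R.≈ ∣ x ∣² R.* ∣ y ∣²
      ∣∣²-⨯    : ∀ k → ∣ k CT.⨯ C.1# ∣² R.≈ (k RT.⨯ R.1#) R.* (k RT.⨯ R.1#)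
      ∣root∣²  : ∀ k .{{_ : NonZero k}} {x} → x CT.^ k C.≈ C.1# → ∣ x ∣² R.≈ R.1#

-- Roots of unity in rings whose only idempotents are 0 and 1

module RootsOfUnity {c ℓ} (C : CommutativeRing c ℓ)
  (connected : RingTheory.IsConnectedℚAlgebra C) where

  open CommutativeRing C hiding (zero)
  open RingTheory C
  open IsConnectedℚAlgebra connected
  open import Relation.Binary.Reasoning.Setoid setoid
  open NatSolver commutativeSemiring

  IsPrimitive : ℕ → Carrier → Set ℓ
  IsPrimitive n z = z ^ n ≈ 1# × (∀ k → 0 ℕ.< k → k ℕ.< n → ¬ (z ^ k ≈ 1#))

  ⨯1≉0 : ∀ n .{{_ : NonZero n}} → ¬ (n ⨯ 1# ≈ 0#)
  ⨯1≉0 n n≈0 = 1≉0 (trans (sym (proj₂ (reciprocal n))) (trans (*-congˡ n≈0) (zeroʳ _)))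

  -- For yⁿ = 1 the mean (1 + y + … + yⁿ⁻¹) / n is idempotent.
  root-dichotomy : ∀ n .{{_ : NonZero n}} {y} → y ^ n ≈ 1# → y ≈ 1# ⊎ geometric n y ≈ 0#
  root-dichotomy n {y} yⁿ≈1 = dichotomy (idempotent (κ * G) idem)
    where
    κ N G : Carrier
    κ = proj₁ (reciprocal n)
    N = n ⨯ 1#
    G = geometric n y
    κN≈1 : κ * N ≈ 1#
    κN≈1 = proj₂ (reciprocal n)
    idem : (κ * G) * (κ * G) ≈ κ * G
    idem = begin
      (κ * G) * (κ * G)  ≈⟨ solve 2 (λ κ G → (κ :* G) :* (κ :* G) := κ :* (κ :* (G :* G))) refl κ G ⟩
      κ * (κ * (G * G))  ≈⟨ *-congˡ (trans (*-congˡ (geometric-square n yⁿ≈1)) (sym (*-assoc κ N G))) ⟩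
      κ * (κ * N * G)    ≈⟨ *-congˡ (trans (*-congʳ κN≈1) (*-identityˡ G)) ⟩
      κ * G              ∎
    G≈N*[κ*G] : G ≈ N * (κ * G)
    G≈N*[κ*G] = begin
      G            ≈⟨ *-identityˡ G ⟨
      1# * G       ≈⟨ *-congʳ κN≈1 ⟨
      κ * N * G    ≈⟨ solve 3 (λ κ N G → κ :* N :* G := N :* (κ :* G)) refl κ N G ⟩
      N * (κ * G)  ∎
    dichotomy : κ * G ≈ 0# ⊎ κ * G ≈ 1# → y ≈ 1# ⊎ G ≈ 0#
    dichotomy (inj₁ e≈0) = inj₂ (trans G≈N*[κ*G] (trans (*-congˡ e≈0) (zeroʳ N)))
    dichotomy (inj₂ e≈1) = inj₁ (begin
      y              ≈⟨ *-identityʳ y ⟨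
      y * 1#         ≈⟨ *-congˡ e≈1 ⟨
      y * (κ * G)    ≈⟨ solve 3 (λ y κ G → y :* (κ :* G) := κ :* (y :* G)) refl y κ G ⟩
      κ * (y * G)    ≈⟨ *-congˡ (geometric-fixed n yⁿ≈1) ⟩
      κ * G          ≈⟨ e≈1 ⟩
      1#             ∎)

  root≟1 : ∀ n .{{_ : NonZero n}} {y} → y ^ n ≈ 1# → Dec (y ≈ 1#)
  root≟1 n yⁿ≈1 with root-dichotomy n yⁿ≈1
  ... | inj₁ y≈1 = yes y≈1
  ... | inj₂ G≈0 = no λ y≈1 → ⨯1≉0 n (trans (sym (geometric-1 n y≈1)) G≈0)

  root≉1⇒geometric≈0 : ∀ n .{{_ : NonZero n}} {y} → y ^ n ≈ 1# → ¬ (y ≈ 1#) → geometric n y ≈ 0#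
  root≉1⇒geometric≈0 n yⁿ≈1 y≉1 with root-dichotomy n yⁿ≈1
  ... | inj₁ y≈1 = contradiction y≈1 y≉1
  ... | inj₂ G≈0 = G≈0

  ^-comm : ∀ x m n → (x ^ m) ^ n ≈ (x ^ n) ^ m
  ^-comm x m n = trans (^-assocʳ x m n) (trans (^-congʳ x (ℕ.*-comm m n)) (sym (^-assocʳ x n m)))

  root-^ : ∀ n {x} → x ^ n ≈ 1# → ∀ k → (x ^ k) ^ n ≈ 1#
  root-^ n {x} xⁿ≈1 k = trans (^-comm x k n) (trans (^-congˡ k xⁿ≈1) (1^ k))

  root-* : ∀ n {x y} → x ^ n ≈ 1# → y ^ n ≈ 1# → (x * y) ^ n ≈ 1#
  root-* n {x} {y} xⁿ≈1 yⁿ≈1 = trans (^-distrib-* x y n) (trans (*-cong xⁿ≈1 yⁿ≈1) (*-identityˡ 1#))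

  root-multiple : ∀ n {x} → x ^ n ≈ 1# → ∀ k → x ^ (k ℕ.* n) ≈ 1#
  root-multiple n {x} xⁿ≈1 k = trans (sym (^-assocʳ x k n)) (root-^ n xⁿ≈1 k)

  -- The inverse of an nth root of unity, over ℂ its complex conjugate, written as a power so that
  -- it is visibly a root of unity again.
  conj : ℕ → Carrier → Carrier
  conj n x = x ^ pred n

  conj-inverseʳ : ∀ n .{{_ : NonZero n}} {x} → x ^ n ≈ 1# → x * conj n x ≈ 1#
  conj-inverseʳ n {x} xⁿ≈1 = trans (^-congʳ x (ℕ.suc-pred n)) xⁿ≈1

  conj-inverseˡ : ∀ n .{{_ : NonZero n}} {x} → x ^ n ≈ 1# → conj n x * x ≈ 1#
  conj-inverseˡ n xⁿ≈1 = trans (*-comm _ _) (conj-inverseʳ n xⁿ≈1)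

  inverse-unique : ∀ {x y z} → z * y ≈ 1# → x * y ≈ 1# → x ≈ z
  inverse-unique {x} {y} {z} zy≈1 xy≈1 = begin
    x            ≈⟨ *-identityʳ x ⟨
    x * 1#       ≈⟨ *-congˡ zy≈1 ⟨
    x * (z * y)  ≈⟨ solve 3 (λ x y z → x :* (z :* y) := z :* (x :* y)) refl x y z ⟩
    z * (x * y)  ≈⟨ *-congˡ xy≈1 ⟩
    z * 1#       ≈⟨ *-identityʳ z ⟩
    z            ∎

  quotient≈1⇒≈ : ∀ n .{{_ : NonZero n}} {x y} → y ^ n ≈ 1# → x * conj n y ≈ 1# → x ≈ y
  quotient≈1⇒≈ n yⁿ≈1 = inverse-unique (conj-inverseʳ n yⁿ≈1)

  -- Multiplying zⁱ = zʲ by zⁿ⁻ʲ produces the exponent n - j + i, which lies strictly between 0 and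
  -- n.
  primitive-injective-< : ∀ n {z} → IsPrimitive n z → ∀ {i j} → i ℕ.< j → j ℕ.< n → ¬ (z ^ i ≈ z ^ j)
  primitive-injective-< n {z} (zⁿ≈1 , minimal) {i} {j} i<j j<n zⁱ≈zʲ =
    minimal (n ℕ.∸ j ℕ.+ i) (ℕ.<-≤-trans (ℕ.m<n⇒0<n∸m j<n) (ℕ.m≤m+n _ i))
      (ℕ.<-≤-trans (ℕ.+-monoʳ-< (n ℕ.∸ j) i<j) (ℕ.≤-reflexive (ℕ.m∸n+n≡m (ℕ.<⇒≤ j<n))))
      (begin
        z ^ (n ℕ.∸ j ℕ.+ i)    ≈⟨ ^-homo-* z (n ℕ.∸ j) i ⟩
        z ^ (n ℕ.∸ j) * z ^ i  ≈⟨ *-congˡ zⁱ≈zʲ ⟩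
        z ^ (n ℕ.∸ j) * z ^ j  ≈⟨ ^-homo-* z (n ℕ.∸ j) j ⟨
        z ^ (n ℕ.∸ j ℕ.+ j)    ≈⟨ ^-congʳ z (ℕ.m∸n+n≡m (ℕ.<⇒≤ j<n)) ⟩
        z ^ n                  ≈⟨ zⁿ≈1 ⟩
        1#                     ∎)

  primitive-injective : ∀ n {z} → IsPrimitive n z → ∀ {i j} → i ℕ.< n → j ℕ.< n → z ^ i ≈ z ^ j → i ≡ j
  primitive-injective n prim {i} {j} i<n j<n eq with ℕ.<-cmp i j
  ... | tri< i<j _ _ = contradiction eq (primitive-injective-< n prim i<j j<n)
  ... | tri≈ _ i≡j _ = i≡j
  ... | tri> _ _ j<i = contradiction (sym eq) (primitive-injective-< n prim j<i i<n)

  -- Orthogonality of characters: were no x w⁻ᵏ equal to 1, then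
  -- n = ∑ⱼ xʲ ∑ₖ (w⁻ʲ)ᵏ = ∑ₖ ∑ⱼ (x w⁻ᵏ)ʲ = 0.
  root⇒power : ∀ n .{{_ : NonZero n}} {w x} → IsPrimitive n w → x ^ n ≈ 1# →
    Σ[ k ∈ Fin n ] x ≈ w ^ toℕ k
  root⇒power n@(suc n-1) {w} {x} prim@(wⁿ≈1 , minimal) xⁿ≈1
    with Fin.any? (λ k → root≟1 n (root-* n xⁿ≈1 (root-^ n (root-^ n wⁿ≈1 (toℕ k)) n-1)))
  ... | yes (k , eq) = k , quotient≈1⇒≈ n (root-^ n wⁿ≈1 (toℕ k)) eq
  ... | no none = contradiction (begin
      n ⨯ 1#
        ≈⟨ trans (*-identityˡ _) (geometric-1 n refl) ⟨
      x ^ 0 * geometric n (conj n w ^ 0)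
        ≈⟨ sum-single {n} (λ j → x ^ toℕ j * geometric n (conj n w ^ toℕ j)) zero vanishing ⟨
      sum {n} (λ j → x ^ toℕ j * geometric n (conj n w ^ toℕ j))
        ≈⟨ sum-cong n (λ j → *-sumˡ n (x ^ toℕ j) (λ k → (conj n w ^ toℕ j) ^ toℕ k)) ⟩
      sum {n} (λ j → sum {n} (λ k → x ^ toℕ j * (conj n w ^ toℕ j) ^ toℕ k))
        ≈⟨ ∑-comm {n} {n} (λ j k → x ^ toℕ j * (conj n w ^ toℕ j) ^ toℕ k) ⟩
      sum {n} (λ k → sum {n} (λ j → x ^ toℕ j * (conj n w ^ toℕ j) ^ toℕ k))
        ≈⟨ sum-cong n (λ k → sum-cong n (λ j → sym (trans (^-distrib-* x _ (toℕ j))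
             (*-congˡ (trans (^-congˡ (toℕ j) (^-comm w (toℕ k) n-1)) (^-comm (conj n w) (toℕ k) (toℕ j))))))) ⟩
      sum {n} (λ k → geometric n (x * conj n (w ^ toℕ k)))
        ≈⟨ sum-zero n (λ k → root≉1⇒geometric≈0 n
             (root-* n xⁿ≈1 (root-^ n (root-^ n wⁿ≈1 (toℕ k)) n-1)) (λ eq → none (k , eq))) ⟩
      0# ∎) (⨯1≉0 n)
    where
    vanishing : ∀ j → j ≢ zero → x ^ toℕ j * geometric n (conj n w ^ toℕ j) ≈ 0#
    vanishing zero      j≢0 = contradiction ≡.refl j≢0
    vanishing j@(suc _) _   = trans (*-congˡ (root≉1⇒geometric≈0 n (root-^ n (root-^ n wⁿ≈1 n-1) (toℕ j))
      (λ eq → minimal (toℕ j) (ℕ.s≤s ℕ.z≤n) (Fin.toℕ<n j) (begin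
        w ^ toℕ j                        ≈⟨ *-identityʳ _ ⟨
        w ^ toℕ j * 1#                   ≈⟨ *-congˡ (trans (^-comm w (toℕ j) n-1) eq) ⟨
        w ^ toℕ j * conj n (w ^ toℕ j)   ≈⟨ conj-inverseʳ n (root-^ n wⁿ≈1 (toℕ j)) ⟩
        1#                               ∎)))) (zeroʳ _)

  root-gcd : ∀ {m n d x} → Bézout.Identity d m n → x ^ m ≈ 1# → x ^ n ≈ 1# → x ^ d ≈ 1#
  root-gcd {m} {n} {d} {x} (Bézout.+- a b eq) xᵐ≈1 xⁿ≈1 = begin
    x ^ d                    ≈⟨ *-identityʳ _ ⟨
    x ^ d * 1#               ≈⟨ *-congˡ (root-multiple n xⁿ≈1 b) ⟨
    x ^ d * x ^ (b ℕ.* n)    ≈⟨ ^-homo-* x d (b ℕ.* n) ⟨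
    x ^ (d ℕ.+ b ℕ.* n)      ≈⟨ ^-congʳ x eq ⟩
    x ^ (a ℕ.* m)            ≈⟨ root-multiple m xᵐ≈1 a ⟩
    1#                       ∎
  root-gcd (Bézout.-+ a b eq) xᵐ≈1 xⁿ≈1 = root-gcd (Bézout.+- b a eq) xⁿ≈1 xᵐ≈1

  primitive-^ : ∀ q r .{{_ : NonZero q}} {x} → IsPrimitive (q ℕ.* r) x → IsPrimitive r (x ^ q)
  primitive-^ q r {x} (root , minimal) = trans (^-assocʳ x q r) root , λ k 0<k k<r eq →
    minimal (q ℕ.* k) (≡.subst (ℕ._< q ℕ.* k) (ℕ.*-zeroʳ q) (ℕ.*-monoʳ-< q 0<k))
      (ℕ.*-monoʳ-< q k<r) (trans (sym (^-assocʳ x q k)) eq)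

  -- If xᵏ = 1 for some 0 < k < n, then xⁿᐟᵖ = 1 for some prime p dividing n,
  -- hence also r, and (x^q)^(r/p) = 1.
  ^-primitive : ∀ q r .{{_ : NonZero q}} .{{_ : NonZero r}} → (∀ {p} → Prime p → p ∣ q ℕ.* r → p ∣ r) →
    ∀ {x} → IsPrimitive r (x ^ q) → IsPrimitive (q ℕ.* r) x
  ^-primitive q r primes {x} (root , minimal) = xⁿ≈1 , λ k 0<k k<n xᵏ≈1 →
    notSmaller k 0<k k<n xᵏ≈1 (Bézout.lemma k (q ℕ.* r))
    where
    xⁿ≈1 : x ^ (q ℕ.* r) ≈ 1#
    xⁿ≈1 = trans (sym (^-assocʳ x q r)) root
    notSmaller : ∀ k → 0 ℕ.< k → k ℕ.< q ℕ.* r → x ^ k ≈ 1# → ¬ (Bézout.Lemma k (q ℕ.* r))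
    notSmaller k 0<k k<n xᵏ≈1 (Bézout.result d g b) =
      let h , 0<h , h<r , divides f q*h≡f*d = proper-divisor-descends q r primes (GCD.gcd∣n g)
            (ℕ.≤-<-trans (∣⇒≤ {{ℕ.>-nonZero 0<k}} (GCD.gcd∣m g)) k<n)
      in minimal h 0<h h<r (trans (^-assocʳ x q h)
           (trans (^-congʳ x q*h≡f*d) (root-multiple d (root-gcd b xᵏ≈1 xⁿ≈1) f)))

  -- Scaled by xᵢ⁻¹, the difference becomes 1 - y for the root of unity y = xⱼ / xᵢ ≠ 1, whose
  -- inverse is `geometric² n y` divided by n.
  roots-separated : ∀ n .{{_ : NonZero n}} {k} (x : Fin k → Carrier) → (∀ i → x i ^ n ≈ 1#) →
    (∀ i j → x i ≈ x j → i ≡ j) → Separated x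
  roots-separated n x root distinct i j i≢j = xᵢ⁻¹ * (T * κ) , (begin
    (x i - x j) * (xᵢ⁻¹ * (T * κ))     ≈⟨ trans (sym (*-assoc _ _ _)) (sym (*-assoc _ _ _)) ⟩
    (x i - x j) * xᵢ⁻¹ * T * κ         ≈⟨ *-congʳ (*-congʳ 1-y) ⟩
    (1# - x j * xᵢ⁻¹) * T * κ          ≈⟨ *-congʳ (geometric≈0⇒unit n (root≉1⇒geometric≈0 n
                                            (root-* n (root j) (root-^ n (root i) (pred n))) y≉1)) ⟩
    n ⨯ 1# * κ                         ≈⟨ trans (*-comm _ _) (proj₂ (reciprocal n)) ⟩
    1#                                 ∎)
    where
    xᵢ⁻¹ T κ : Carrier
    xᵢ⁻¹ = conj n (x i)
    T = geometric² n (x j * xᵢ⁻¹)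
    κ = proj₁ (reciprocal n)
    y≉1 : ¬ (x j * xᵢ⁻¹ ≈ 1#)
    y≉1 eq = i≢j (≡.sym (distinct j i (quotient≈1⇒≈ n (root i) eq)))
    1-y : (x i - x j) * xᵢ⁻¹ ≈ 1# - x j * xᵢ⁻¹
    1-y = trans (distribʳ xᵢ⁻¹ _ _)
      (+-cong (conj-inverseʳ n (root i)) (sym (-‿distribˡ-* (x j) xᵢ⁻¹)))

  primitive-resp-≈ : ∀ n {x y} → x ≈ y → IsPrimitive n x → IsPrimitive n y
  primitive-resp-≈ n x≈y (root , minimal) = trans (^-congˡ n (sym x≈y)) root ,
    λ k 0<k k<n yᵏ≈1 → minimal k 0<k k<n (trans (^-congˡ k x≈y) yᵏ≈1)

  -- The length m is not tied to n: the order can then be rewritten as q r without touching the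
  -- index type, and the relation between the lengths for n and r is a consequence of the bijection
  -- between the lists.
  record Enumerates (n : ℕ) {m} (ζ : Fin m → Carrier) : Set (c ⊔ ℓ) where
    field
      isPrimitive : ∀ i → IsPrimitive n (ζ i)
      distinct    : ∀ i j → ζ i ≈ ζ j → i ≡ j
      complete    : ∀ z → IsPrimitive n z → ∃[ i ] z ≈ ζ i

    root : ∀ i → ζ i ^ n ≈ 1#
    root i = proj₁ (isPrimitive i)

    separated : .{{_ : NonZero n}} → Separated ζ
    separated = roots-separated n ζ root distinct

  -- The fibres of the qth power map

  module Comparison (q r : ℕ) .{{_ : NonZero q}} .{{_ : NonZero r}}
    (primes : ∀ {p} → Prime p → p ∣ q ℕ.* r → p ∣ r)
    {m m′ : ℕ} (ζ : Fin m → Carrier) (ξ : Fin m′ → Carrier)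
    (ζ-enum : Enumerates (q ℕ.* r) ζ) (ξ-enum : Enumerates r ξ) (i₀ : Fin m) where

    private
      module ζ = Enumerates ζ-enum
      module ξ = Enumerates ξ-enum

      n : ℕ
      n = q ℕ.* r

      instance
        n-nonZero : NonZero n
        n-nonZero = ℕ.m*n≢0 q r

      -- Since z has order q r, its power w has order q, so w generates the qth roots of unity, by
      -- which the elements of one fibre differ.
      z w : Carrier
      z = ζ i₀
      w = z ^ r

      z-root : z ^ n ≈ 1#
      z-root = ζ.root i₀

      w-primitive : IsPrimitive q w
      w-primitive = primitive-^ r q (≡.subst (λ k → IsPrimitive k z) (ℕ.*-comm q r) (ζ.isPrimitive i₀))

      exponent : ∀ a → Σ[ t ∈ Fin r ] ξ a ≈ (z ^ q) ^ toℕ t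
      exponent a = root⇒power r (primitive-^ q r (ζ.isPrimitive i₀)) (ξ.root a)

      -- A qth root of ξ_a, available because ξ_a is a power of z^q: the same power of z will do.
      lift : Fin m′ → Carrier
      lift a = z ^ toℕ (proj₁ (exponent a))

      lift-root : ∀ a → lift a ^ n ≈ 1#
      lift-root a = root-^ n z-root (toℕ (proj₁ (exponent a)))

      lift^q : ∀ a → lift a ^ q ≈ ξ a
      lift^q a = trans (^-comm z (toℕ (proj₁ (exponent a))) q) (sym (proj₂ (exponent a)))

      lift*w^q : ∀ a (s : Fin q) → (lift a * w ^ toℕ s) ^ q ≈ ξ a
      lift*w^q a s = trans (^-distrib-* (lift a) _ q)
        (trans (*-cong (lift^q a) (root-^ q (proj₁ w-primitive) (toℕ s))) (*-identityʳ _))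

      -- The product has qth power ξ_a, which is primitive of order r; the hypothesis on primes
      -- makes the product itself primitive of order q r, hence listed by ζ.
      fibreElement : ∀ a s → ∃[ i ] lift a * w ^ toℕ s ≈ ζ i
      fibreElement a s = ζ.complete (lift a * w ^ toℕ s)
        (^-primitive q r primes (primitive-resp-≈ r (sym (lift*w^q a s)) (ξ.isPrimitive a)))

      residue : ∀ i → ∃[ a ] ζ i ^ q ≈ ξ a
      residue i = ξ.complete (ζ i ^ q) (primitive-^ q r (ζ.isPrimitive i))

    reduce : Fin m → Fin m′
    reduce i = proj₁ (residue i)

    fibre : Fin m′ → Fin q → Fin m
    fibre a s = proj₁ (fibreElement a s)

    ζ^q≈ξ : ∀ i → ζ i ^ q ≈ ξ (reduce i)
    ζ^q≈ξ i = proj₂ (residue i)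

    reduce-fibre : ∀ a s → reduce (fibre a s) ≡ a
    reduce-fibre a s = ξ.distinct _ _ (trans (sym (ζ^q≈ξ (fibre a s)))
      (trans (^-congˡ q (sym (proj₂ (fibreElement a s)))) (lift*w^q a s)))

    private
      -- ζᵢ and the lift of its residue have the same qth power, so their quotient is a qth root of
      -- unity.
      cofactor : ∀ i → Σ[ s ∈ Fin q ] ζ i * conj n (lift (reduce i)) ≈ w ^ toℕ s
      cofactor i = root⇒power q w-primitive (begin
        (ζ i * conj n l) ^ q        ≈⟨ ^-distrib-* (ζ i) (conj n l) q ⟩
        ζ i ^ q * conj n l ^ q      ≈⟨ *-cong (trans (ζ^q≈ξ i) (sym (lift^q (reduce i)))) refl ⟩
        l ^ q * conj n l ^ q        ≈⟨ ^-distrib-* l (conj n l) q ⟨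
        (l * conj n l) ^ q          ≈⟨ trans (^-congˡ q (conj-inverseʳ n (lift-root (reduce i)))) (1^ q) ⟩
        1#                          ∎)
        where
        l : Carrier
        l = lift (reduce i)

      index : Fin m → Fin q
      index i = proj₁ (cofactor i)

      ζ≈lift*w : ∀ i → ζ i ≈ lift (reduce i) * w ^ toℕ (index i)
      ζ≈lift*w i = begin
        ζ i                     ≈⟨ *-identityʳ _ ⟨
        ζ i * 1#                ≈⟨ *-congˡ (conj-inverseʳ n (lift-root (reduce i))) ⟨
        ζ i * (l * conj n l)    ≈⟨ solve 3 (λ x l c → x :* (l :* c) := l :* (x :* c)) refl (ζ i) l (conj n l) ⟩
        l * (ζ i * conj n l)    ≈⟨ *-congˡ (proj₂ (cofactor i)) ⟩
        l * w ^ toℕ (index i)   ∎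
        where
        l : Carrier
        l = lift (reduce i)

      root-cancelˡ : ∀ {x y y′} → x ^ n ≈ 1# → x * y ≈ x * y′ → y ≈ y′
      root-cancelˡ {x} {y} {y′} xⁿ≈1 eq = trans (sym (undo y)) (trans (*-congˡ eq) (undo y′))
        where
        undo : ∀ y → conj n x * (x * y) ≈ y
        undo y = trans (sym (*-assoc _ _ _)) (trans (*-congʳ (conj-inverseˡ n xⁿ≈1)) (*-identityˡ y))

      index-fibre : ∀ a s → index (fibre a s) ≡ s
      index-fibre a s = Fin.toℕ-injective (primitive-injective q w-primitive
        (Fin.toℕ<n (index (fibre a s))) (Fin.toℕ<n s) (root-cancelˡ (lift-root a) (begin
          lift a * w ^ toℕ (index (fibre a s))
            ≡⟨ ≡.cong (λ b → lift b * w ^ toℕ (index (fibre a s))) (reduce-fibre a s) ⟨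
          lift (reduce (fibre a s)) * w ^ toℕ (index (fibre a s))
            ≈⟨ ζ≈lift*w (fibre a s) ⟨
          ζ (fibre a s)
            ≈⟨ proj₂ (fibreElement a s) ⟨
          lift a * w ^ toℕ s ∎)))

      fibre-reduce : ∀ i → fibre (reduce i) (index i) ≡ i
      fibre-reduce i = ζ.distinct _ _
        (trans (sym (proj₂ (fibreElement (reduce i) (index i)))) (sym (ζ≈lift*w i)))

    fibration : Permutation (m′ ℕ.* q) m
    fibration = permutation (λ l → uncurry fibre (remQuot q l)) (λ i → combine (reduce i) (index i))
      (λ i → ≡.trans (≡.cong (uncurry fibre) (Fin.remQuot-combine (reduce i) (index i))) (fibre-reduce i))
      (λ l → let a , s = remQuot q l in
        ≡.trans (≡.cong₂ combine (reduce-fibre a s) (index-fibre a s)) (Fin.combine-remQuot {m′} q l))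

    -- Comparing the cardinalities of the two sides of the bijection; for the lists at hand this is
    -- φ(n) = q φ(r).
    m≡m′*q : m ≡ m′ ℕ.* q
    m≡m′*q = ≡.sym (↔⇒≡ fibration)

    -- Exponents are split by division by q, whereas indices of roots are split by `fibration`.
    -- These two identifications of `Fin m` with pairs are unrelated.
    digits : Fin m → Fin m′ × Fin q
    digits j = remQuot q (Fin.cast m≡m′*q j)

    undigits : Fin m′ → Fin q → Fin m
    undigits b c = Fin.cast (≡.sym m≡m′*q) (combine b c)

    digits-undigits : ∀ b c → digits (undigits b c) ≡ (b , c)
    digits-undigits b c = ≡.trans
      (≡.cong (remQuot q) (Fin.cast-involutive m≡m′*q (≡.sym m≡m′*q) (combine b c)))
      (Fin.remQuot-combine b c)

    toℕ-undigits : ∀ b c → toℕ (undigits b c) ≡ q ℕ.* toℕ b ℕ.+ toℕ c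
    toℕ-undigits b c = ≡.trans (Fin.toℕ-cast _ (combine b c)) (Fin.toℕ-combine b c)

    -- The ring of values is a parameter because such sums occur in C for matrix products and in the
    -- ring of squared moduli for norms.
    module Sums {c′ ℓ′} (R : CommutativeRing c′ ℓ′) where
      private
        module R = CommutativeRing R
        module RT = RingTheory R

      sum-fibres : ∀ (f : Fin m → R.Carrier) →
        RT.sum f R.≈ RT.sum {m′} (λ a → RT.sum {q} (λ s → f (fibre a s)))
      sum-fibres f = R.trans (RT.∑-permute f fibration)
        (R.trans (RT.sum-combine m′ (λ l → f (fibration ⟨$⟩ʳ l)))
          (RT.sum-cong m′ (λ a → RT.sum-cong q (λ s →
            R.reflexive (≡.cong (f ∘ uncurry fibre) (Fin.remQuot-combine a s))))))

      sum-digits : ∀ (f : Fin m → R.Carrier) →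
        RT.sum f R.≈ RT.sum {m′} (λ b → RT.sum {q} (λ c → f (undigits b c)))
      sum-digits f = R.trans (sum-cast m≡m′*q f) (RT.sum-combine m′ (f ∘ Fin.cast (≡.sym m≡m′*q)))
        where
        sum-cast : ∀ {k l} (eq : k ≡ l) (f : Fin k → R.Carrier) →
          RT.sum f R.≈ RT.sum (f ∘ Fin.cast (≡.sym eq))
        sum-cast {k} ≡.refl f = RT.sum-cong k (λ i → R.reflexive (≡.cong f (≡.sym (Fin.cast-is-id ≡.refl i))))

    -- With j = q b + c and ξ_a = ζᵢ^q, the inverse of the Vandermonde
    -- matrix of ζ has (j, i) entry ζᵢ⁻ᶜ U b a / q, where U is that of ξ.
    liftInverse : (Fin m′ → Fin m′ → Carrier) → Fin m → Fin m → Carrier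
    liftInverse U j i =
      proj₁ (reciprocal q) * conj n (ζ i) ^ toℕ (proj₂ (digits j)) * U (proj₁ (digits j)) (reduce i)

    private
      κ : Carrier
      κ = proj₁ (reciprocal q)

    -- With ζᵢ^q = ξ_a one has ζᵢ^(q b + c) = ξ_a^b ζᵢᶜ, so the double sum factors: c contributes a
    -- geometric sum in ζᵢ / ζᵢ′, and b an entry of the product of the smaller Vandermonde matrix
    -- with U.
    eval-liftInverse : ∀ U i i′ → eval (λ j → liftInverse U j i′) (ζ i) ≈
      κ * geometric q (ζ i * conj n (ζ i′)) * eval (λ b → U b (reduce i′)) (ξ (reduce i))
    eval-liftInverse U i i′ = begin
      sum {m} (λ j → ζ i ^ toℕ j * liftInverse U j i′)
        ≈⟨ Sums.sum-digits C (λ j → ζ i ^ toℕ j * liftInverse U j i′) ⟩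
      sum {m′} (λ b → sum {q} (λ c → ζ i ^ toℕ (undigits b c) * liftInverse U (undigits b c) i′))
        ≈⟨ sum-cong m′ (λ b → sum-cong q (λ c → term b c)) ⟩
      sum {m′} (λ b → sum {q} (λ c →
          (ζ i * conj n (ζ i′)) ^ toℕ c * (κ * (ξ (reduce i) ^ toℕ b * U b (reduce i′)))))
        ≈⟨ sum-cong m′ (λ b → trans (sym (*-sumʳ q _ _)) (trans (sym (*-assoc _ _ _)) (*-congʳ (*-comm _ _)))) ⟩
      sum {m′} (λ b → κ * geometric q (ζ i * conj n (ζ i′)) * (ξ (reduce i) ^ toℕ b * U b (reduce i′)))
        ≈⟨ *-sumˡ m′ _ _ ⟨
      κ * geometric q (ζ i * conj n (ζ i′)) * eval (λ b → U b (reduce i′)) (ξ (reduce i)) ∎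
      where
      term : ∀ b c → ζ i ^ toℕ (undigits b c) * liftInverse U (undigits b c) i′ ≈
        (ζ i * conj n (ζ i′)) ^ toℕ c * (κ * (ξ (reduce i) ^ toℕ b * U b (reduce i′)))
      term b c = begin
        ζ i ^ toℕ (undigits b c) * liftInverse U (undigits b c) i′
          ≡⟨ ≡.cong₂ (λ k d → ζ i ^ k * (κ * ζ̄ ^ toℕ (proj₂ d) * U (proj₁ d) (reduce i′)))
               (toℕ-undigits b c) (digits-undigits b c) ⟩
        ζ i ^ (q ℕ.* toℕ b ℕ.+ toℕ c) * (κ * ζ̄ ^ toℕ c * u)
          ≈⟨ *-congʳ (trans (^-homo-* (ζ i) (q ℕ.* toℕ b) (toℕ c)) (*-congʳ
               (trans (sym (^-assocʳ (ζ i) q (toℕ b))) (^-congˡ (toℕ b) (ζ^q≈ξ i))))) ⟩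
        ξ (reduce i) ^ toℕ b * ζ i ^ toℕ c * (κ * ζ̄ ^ toℕ c * u)
          ≈⟨ solve 5 (λ x y κ y′ u → x :* y :* (κ :* y′ :* u) := (y :* y′) :* (κ :* (x :* u))) refl
               (ξ (reduce i) ^ toℕ b) (ζ i ^ toℕ c) κ (ζ̄ ^ toℕ c) u ⟩
        (ζ i ^ toℕ c * ζ̄ ^ toℕ c) * (κ * (ξ (reduce i) ^ toℕ b * u))
          ≈⟨ *-congʳ (^-distrib-* (ζ i) ζ̄ (toℕ c)) ⟨
        (ζ i * ζ̄) ^ toℕ c * (κ * (ξ (reduce i) ^ toℕ b * u)) ∎
        where
        ζ̄ u : Carrier
        ζ̄ = conj n (ζ i′)
        u = U b (reduce i′)

    module _ (U : Fin m′ → Fin m′ → Carrier)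
      (U-diag : ∀ a → eval (λ b → U b a) (ξ a) ≈ 1#)
      (U-off : ∀ a a′ → a ≢ a′ → eval (λ b → U b a′) (ξ a) ≈ 0#) where

      liftInverse-diag : ∀ i → eval (λ j → liftInverse U j i) (ζ i) ≈ 1#
      liftInverse-diag i = trans (eval-liftInverse U i i) (trans (*-cong
        (trans (*-congˡ (geometric-1 q (conj-inverseʳ n (ζ.root i)))) (proj₂ (reciprocal q)))
        (U-diag (reduce i))) (*-identityˡ 1#))

      -- If the fibres differ, the entry of the smaller product vanishes. If they agree, ζᵢ / ζᵢ′ is
      -- a qth root of unity other than 1, and the geometric sum vanishes.
      liftInverse-off : ∀ i i′ → i ≢ i′ → eval (λ j → liftInverse U j i′) (ζ i) ≈ 0#
      liftInverse-off i i′ i≢i′ = trans (eval-liftInverse U i i′) (vanish (reduce i Fin.≟ reduce i′))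
        where
        y : Carrier
        y = ζ i * conj n (ζ i′)
        y-root : reduce i ≡ reduce i′ → y ^ q ≈ 1#
        y-root eq = begin
          (ζ i * conj n (ζ i′)) ^ q         ≈⟨ ^-distrib-* (ζ i) _ q ⟩
          ζ i ^ q * conj n (ζ i′) ^ q
            ≈⟨ *-congʳ (trans (ζ^q≈ξ i) (trans (reflexive (≡.cong ξ eq)) (sym (ζ^q≈ξ i′)))) ⟩
          ζ i′ ^ q * conj n (ζ i′) ^ q      ≈⟨ ^-distrib-* (ζ i′) _ q ⟨
          (ζ i′ * conj n (ζ i′)) ^ q        ≈⟨ trans (^-congˡ q (conj-inverseʳ n (ζ.root i′))) (1^ q) ⟩
          1#                                ∎
        vanish : Dec (reduce i ≡ reduce i′) →
          κ * geometric q y * eval (λ b → U b (reduce i′)) (ξ (reduce i)) ≈ 0#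
        vanish (no  a≢a′) = trans (*-congˡ (U-off (reduce i) (reduce i′) a≢a′)) (zeroʳ _)
        vanish (yes a≡a′) = trans (*-congʳ (trans (*-congˡ
          (root≉1⇒geometric≈0 q (y-root a≡a′) (λ y≈1 → i≢i′ (ζ.distinct i i′ (quotient≈1⇒≈ n (ζ.root i′) y≈1)))))
          (zeroʳ κ))) (zeroˡ _)

      -- Columns are coefficient vectors of polynomials, and those of V and of `liftInverse U` take
      -- the same values at the nodes ζ. This carries the explicit formula over to an arbitrary
      -- right inverse.
      inverse-unique-lift : (V : Fin m → Fin m → Carrier) → (∀ i → eval (λ j → V j i) (ζ i) ≈ 1#) →
        (∀ i i′ → i ≢ i′ → eval (λ j → V j i′) (ζ i) ≈ 0#) → ∀ j i → V j i ≈ liftInverse U j i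
      inverse-unique-lift V V-diag V-off j i =
        eval-injective ζ ζ.separated (λ j → V j i) (λ j → liftInverse U j i) agree j
        where
        split : ∀ {i′} → Dec (i′ ≡ i) →
          eval (λ j → V j i) (ζ i′) ≈ eval (λ j → liftInverse U j i) (ζ i′)
        split      (yes ≡.refl) = trans (V-diag i) (sym (liftInverse-diag i))
        split {i′} (no i′≢i)    = trans (V-off i′ i i′≢i) (sym (liftInverse-off i′ i i′≢i))
        agree : ∀ i′ → eval (λ j → V j i) (ζ i′) ≈ eval (λ j → liftInverse U j i) (ζ i′)
        agree i′ = split (i′ Fin.≟ i)

    -- The Frobenius norm of the inverse

    module Norms {c′ ℓ′} (R : CommutativeRing c′ ℓ′) (modulus : SquaredModulus C R) where

      private
        module R = CommutativeRing R
        module RT = RingTheory R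
        open Sums R
        open SquaredModulus modulus

      -- Each squared modulus of an entry of U occurs q times through the remainder c and q times
      -- through the members of a fibre, and each occurrence is weighted by the squared modulus of 1
      -- / q.
      frobenius-liftInverse : ∀ U →
        RT.sum {m} (λ j → RT.sum {m} (λ i → ∣ liftInverse U j i ∣²)) R.≈
        RT.sum {m′} (λ b → RT.sum {m′} (λ a → ∣ U b a ∣²))
      frobenius-liftInverse U = R.trans
        (sum-digits (λ j → RT.sum {m} (λ i → ∣ liftInverse U j i ∣²)))
        (RT.sum-cong m′ (λ b → R.trans (RT.sum-const q _ (λ c → row b c))
          (R.trans (RT.⨯≈⨯1* q _) (R.trans (RT.*-sumˡ m′ (q RT.⨯ R.1#) _)
            (RT.sum-cong m′ (λ a → cancel ∣ U b a ∣²))))))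
        where
        K : R.Carrier
        K = ∣ κ ∣²
        -- The element κ q = 1 counts as a root of unity of order 1, which gives the squared modulus
        -- of 1.
        QQK≈1 : (q RT.⨯ R.1#) R.* (q RT.⨯ R.1#) R.* K R.≈ R.1#
        QQK≈1 = R.trans (R.*-congʳ (R.sym (∣∣²-⨯ q))) (R.trans (R.*-comm _ K) (R.trans
          (R.sym (∣∣²-* κ (q ⨯ 1#))) (∣root∣² 1 (trans (*-identityʳ _) (proj₂ (reciprocal q))))))
        cancel : ∀ u → (q RT.⨯ R.1#) R.* (q RT.⨯ (K R.* u)) R.≈ u
        cancel u = R.trans (R.*-congˡ (RT.⨯≈⨯1* q (K R.* u))) (R.trans
          (R.trans (R.sym (R.*-assoc _ _ _)) (R.sym (R.*-assoc _ K u)))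
          (R.trans (R.*-congʳ QQK≈1) (R.*-identityˡ u)))
        entry : ∀ b c i → ∣ liftInverse U (undigits b c) i ∣² R.≈ K R.* ∣ U b (reduce i) ∣²
        entry b c i = R.trans
          (R.reflexive (≡.cong (λ d → ∣ κ * conj n (ζ i) ^ toℕ (proj₂ d) * U (proj₁ d) (reduce i) ∣²)
            (digits-undigits b c)))
          (R.trans (∣∣²-* _ _) (R.*-congʳ (R.trans (∣∣²-* _ _) (R.trans
            (R.*-congˡ (∣root∣² n (root-^ n (root-^ n (ζ.root i) (pred n)) (toℕ c))))
            (R.*-identityʳ K)))))
        row : ∀ b c → RT.sum {m} (λ i → ∣ liftInverse U (undigits b c) i ∣²) R.≈
          RT.sum {m′} (λ a → q RT.⨯ (K R.* ∣ U b a ∣²))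
        row b c = R.trans (RT.sum-cong m (entry b c)) (R.trans (sum-fibres (λ i → K R.* ∣ U b (reduce i) ∣²))
          (RT.sum-cong m′ (λ a → RT.sum-const q _ (λ s →
            R.reflexive (≡.cong (λ a → K R.* ∣ U b a ∣²) (reduce-fibre a s))))))

      frobenius-inverse : (U : Fin m′ → Fin m′ → Carrier) (V : Fin m → Fin m → Carrier) →
        (∀ a → eval (λ b → U b a) (ξ a) ≈ 1#) →
        (∀ a a′ → a ≢ a′ → eval (λ b → U b a′) (ξ a) ≈ 0#) →
        (∀ i → eval (λ j → V j i) (ζ i) ≈ 1#) →
        (∀ i i′ → i ≢ i′ → eval (λ j → V j i′) (ζ i) ≈ 0#) →
        RT.sum {m} (λ j → RT.sum {m} (λ i → ∣ V j i ∣²)) R.≈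
        RT.sum {m′} (λ b → RT.sum {m′} (λ a → ∣ U b a ∣²))
      frobenius-inverse U V U-diag U-off V-diag V-off = R.trans
        (RT.sum-cong m (λ j → RT.sum-cong m (λ i →
          ∣∣²-cong (inverse-unique-lift U U-diag U-off V V-diag V-off j i))))
        (frobenius-liftInverse U)

open import Defs

-- The radical and the totient

rad∣n : ∀ n → rad n ∣ n
rad∣n n = product-distinct-primes-∣
  (Unique.filter⁺ primeDivisor? (Unique.upTo⁺ (suc n)))
  (All.map proj₁ allPrimeDivisors) (All.map proj₂ allPrimeDivisors)
  where
  primeDivisor? = λ p → prime? p ×-dec p ∣? n
  allPrimeDivisors : All (λ p → Prime p × p ∣ n) (primeDivisors n)
  allPrimeDivisors = All.all-filter primeDivisor? (upTo (suc n))

prime∣n⇒prime∣rad : ∀ n .{{_ : NonZero n}} {p} → Prime p → p ∣ n → p ∣ rad n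
prime∣n⇒prime∣rad n {p} pr p∣n = ∈⇒∣product
  (∈-filter⁺ (λ p → prime? p ×-dec p ∣? n) (∈-upTo⁺ (ℕ.s≤s (∣⇒≤ p∣n))) (pr , p∣n))

-- Supplies the base point for the description of the fibres: 1 is coprime to n and heads the list
-- that is filtered in `φ n`.
φ-inhabited : ∀ n .{{_ : NonZero n}} → Fin (φ n)
φ-inhabited n@(suc _) = Any.index
  (∈-filter⁺ (λ k → coprime? k n) {xs = map suc (upTo n)} (here ≡.refl) (1-coprimeTo n))

-- Real and complex numbers

-- x ≈ᵣ y unfolds to Null of the difference of the two sequences.
Null : (ℕ → ℚ) → Set
Null s = ∀ ε → 0ℚ ℚ.< ε → Σ[ N ∈ ℕ ] (∀ n → N ℕ.≤ n → ∣ s n ∣ ℚ.< ε)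

≈ᵣ-pointwise : ∀ {x y} → (∀ n → seq x n ≡ seq y n) → x ≈ᵣ y
≈ᵣ-pointwise {x} {y} eq ε 0<ε = 0 , λ n _ → ≡.subst (ℚ._< ε)
  (≡.cong ∣_∣ (≡.trans (≡.sym (ℚ.+-inverseʳ (seq x n))) (≡.cong (λ q → seq x n ℚ.- q) (eq n)))) 0<ε

≈ᵣ-sym : ∀ {x y} → x ≈ᵣ y → y ≈ᵣ x
≈ᵣ-sym {x} {y} x≈y ε 0<ε = let N , p = x≈y ε 0<ε in
  N , λ n N≤n → ≡.subst (ℚ._< ε) (∣p-q∣≡∣q-p∣ (seq x n) (seq y n)) (p n N≤n)

+-null : ∀ {s t} → Null s → Null t → Null (λ n → s n ℚ.+ t n)
+-null {s} {t} s→0 t→0 ε 0<ε =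
  let M , p = s→0 (½ ℚ.* ε) (half-pos 0<ε)
      N , q = t→0 (½ ℚ.* ε) (half-pos 0<ε)
  in M ℕ.⊔ N , λ n l → ℚ.≤-<-trans (ℚ.∣p+q∣≤∣p∣+∣q∣ (s n) (t n))
    (≡.subst (∣ s n ∣ ℚ.+ ∣ t n ∣ ℚ.<_) (half+half ε)
      (ℚ.+-mono-< (p n (ℕ.m⊔n≤o⇒m≤o M N l)) (q n (ℕ.m⊔n≤o⇒n≤o M N l))))

null-resp-≡ : ∀ {s t} → (∀ n → s n ≡ t n) → Null s → Null t
null-resp-≡ eq s→0 ε 0<ε = let N , p = s→0 ε 0<ε in
  N , λ n N≤n → ≡.subst (λ q → ∣ q ∣ ℚ.< ε) (eq n) (p n N≤n)

≈ᵣ-trans : ∀ {x y z} → x ≈ᵣ y → y ≈ᵣ z → x ≈ᵣ z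
≈ᵣ-trans {x} {y} {z} x≈y y≈z = null-resp-≡
  (λ n → solve 3 (λ x y z → (x :- y) :+ (y :- z) := x :- z) ≡.refl (seq x n) (seq y n) (seq z n))
  (+-null {λ n → seq x n ℚ.- seq y n} x≈y y≈z)
  where open +-*-Solver

+ᵣ-cong : ∀ {x y u v} → x ≈ᵣ y → u ≈ᵣ v → x +ᵣ u ≈ᵣ y +ᵣ v
+ᵣ-cong {x} {y} {u} {v} x≈y u≈v = null-resp-≡
  (λ n → solve 4 (λ x y u v → (x :- y) :+ (u :- v) := (x :+ u) :- (y :+ v)) ≡.refl
    (seq x n) (seq y n) (seq u n) (seq v n))
  (+-null {λ n → seq x n ℚ.- seq y n} x≈y u≈v)
  where open +-*-Solver

-ᵣ-cong : ∀ {x y} → x ≈ᵣ y → -ᵣ x ≈ᵣ -ᵣ y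
-ᵣ-cong {x} {y} x≈y = null-resp-≡
  (λ n → solve 2 (λ x y → y :- x := :- x :- :- y) ≡.refl (seq x n) (seq y n)) (≈ᵣ-sym {x} {y} x≈y)
  where open +-*-Solver

*ᵣ-cong : ∀ {x y u v} → x ≈ᵣ y → u ≈ᵣ v → x *ᵣ u ≈ᵣ y *ᵣ v
*ᵣ-cong {x} {y} {u} {v} x≈y u≈v ε 0<ε =
  let B , 0<B , K , xB = eventually-bounded {seq x} (cauchy x)
      C , 0<C , L , vC = eventually-bounded {seq v} (cauchy v)
      δ , 0<δ , eq = split-between 0<B 0<C 0<ε
      M , p = x≈y δ 0<δ
      N , q = u≈v δ 0<δ
  in (K ℕ.⊔ L) ℕ.⊔ (M ℕ.⊔ N) , λ n l →
    let KL = ℕ.m⊔n≤o⇒m≤o (K ℕ.⊔ L) (M ℕ.⊔ N) l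
        MN = ℕ.m⊔n≤o⇒n≤o (K ℕ.⊔ L) (M ℕ.⊔ N) l
    in ∣ab-cd∣-< (seq x n) (seq u n) (seq y n) (seq v n) 0<B 0<C eq
      (xB n (ℕ.m⊔n≤o⇒m≤o K L KL)) (vC n (ℕ.m⊔n≤o⇒n≤o K L KL))
      (p n (ℕ.m⊔n≤o⇒m≤o M N MN)) (q n (ℕ.m⊔n≤o⇒n≤o M N MN))

-- Operations act termwise on sequences, so apart from equivalence and congruence each law is an
-- identity between rationals.
ℝ-commutativeRing : CommutativeRing 0ℓ 0ℓ
ℝ-commutativeRing = record
  { Carrier = ℝ ; _≈_ = _≈ᵣ_ ; _+_ = _+ᵣ_ ; _*_ = _*ᵣ_ ; -_ = -ᵣ_
  ; 0# = fromℚ 0ℚ ; 1# = fromℚ 1ℚ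
  ; isCommutativeRing = record
    { isRing = record
      { +-isAbelianGroup = record
        { isGroup = record
          { isMonoid = record
            { isSemigroup = record
              { isMagma = record
                { isEquivalence = record
                  { refl  = λ {x} → ≈ᵣ-pointwise {x} {x} (λ _ → ≡.refl)
                  ; sym   = λ {x} {y} → ≈ᵣ-sym {x} {y}
                  ; trans = λ {x} {y} {z} → ≈ᵣ-trans {x} {y} {z}
                  }
                ; ∙-cong = λ {x} {y} {u} {v} → +ᵣ-cong {x} {y} {u} {v}
                }
              ; assoc = λ x y z → ≈ᵣ-pointwise {(x +ᵣ y) +ᵣ z} {x +ᵣ (y +ᵣ z)} λ n →
                  ℚ.+-assoc (seq x n) (seq y n) (seq z n)
              }
            ; identity = (λ x → ≈ᵣ-pointwise {fromℚ 0ℚ +ᵣ x} {x} λ n → ℚ.+-identityˡ (seq x n))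
                       , (λ x → ≈ᵣ-pointwise {x +ᵣ fromℚ 0ℚ} {x} λ n → ℚ.+-identityʳ (seq x n))
            }
          ; inverse = (λ x → ≈ᵣ-pointwise { -ᵣ x +ᵣ x} {fromℚ 0ℚ} λ n → ℚ.+-inverseˡ (seq x n))
                    , (λ x → ≈ᵣ-pointwise {x +ᵣ -ᵣ x} {fromℚ 0ℚ} λ n → ℚ.+-inverseʳ (seq x n))
          ; ⁻¹-cong = λ {x} {y} → -ᵣ-cong {x} {y}
          }
        ; comm = λ x y → ≈ᵣ-pointwise {x +ᵣ y} {y +ᵣ x} λ n → ℚ.+-comm (seq x n) (seq y n)
        }
      ; *-cong = λ {x} {y} {u} {v} → *ᵣ-cong {x} {y} {u} {v}
      ; *-assoc = λ x y z → ≈ᵣ-pointwise {(x *ᵣ y) *ᵣ z} {x *ᵣ (y *ᵣ z)} λ n →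
          ℚ.*-assoc (seq x n) (seq y n) (seq z n)
      ; *-identity = (λ x → ≈ᵣ-pointwise {fromℚ 1ℚ *ᵣ x} {x} λ n → ℚ.*-identityˡ (seq x n))
                   , (λ x → ≈ᵣ-pointwise {x *ᵣ fromℚ 1ℚ} {x} λ n → ℚ.*-identityʳ (seq x n))
      ; distrib = (λ x y z → ≈ᵣ-pointwise {x *ᵣ (y +ᵣ z)} {x *ᵣ y +ᵣ x *ᵣ z} λ n →
                    ℚ.*-distribˡ-+ (seq x n) (seq y n) (seq z n))
                , (λ x y z → ≈ᵣ-pointwise {(y +ᵣ z) *ᵣ x} {y *ᵣ x +ᵣ z *ᵣ x} λ n →
                    ℚ.*-distribʳ-+ (seq x n) (seq y n) (seq z n))
      }
    ; *-comm = λ x y → ≈ᵣ-pointwise {x *ᵣ y} {y *ᵣ x} λ n → ℚ.*-comm (seq x n) (seq y n)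
    }
  }

module ℝ′ = CommutativeRing ℝ-commutativeRing

≈-pointwise : ∀ {z w} → (∀ n → seq (re z) n ≡ seq (re w) n) → (∀ n → seq (im z) n ≡ seq (im w) n) → z ≈ w
≈-pointwise {z} {w} p q = ≈ᵣ-pointwise {re z} {re w} p , ≈ᵣ-pointwise {im z} {im w} q

ℂ-commutativeRing : CommutativeRing 0ℓ 0ℓ
ℂ-commutativeRing = record
  { Carrier = ℂ ; _≈_ = _≈_ ; _+_ = _+ᶜ_ ; _*_ = _*ᶜ_ ; -_ = -ᶜ_ ; 0# = 0ᶜ ; 1# = 1ᶜ
  ; isCommutativeRing = record
    { isRing = record
      { +-isAbelianGroup = record
        { isGroup = record
          { isMonoid = record
            { isSemigroup = record
              { isMagma = record
                { isEquivalence = record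
                  { refl  = λ {z} → ℝ′.refl {re z} , ℝ′.refl {im z}
                  ; sym   = λ {z} {w} (p , q) → ℝ′.sym {re z} {re w} p , ℝ′.sym {im z} {im w} q
                  ; trans = λ {z} {w} {v} (p , q) (p′ , q′) →
                      ℝ′.trans {re z} {re w} {re v} p p′ , ℝ′.trans {im z} {im w} {im v} q q′
                  }
                ; ∙-cong = λ {z} {w} {u} {v} (p , q) (p′ , q′) →
                    ℝ′.+-cong {re z} {re w} {re u} {re v} p p′ , ℝ′.+-cong {im z} {im w} {im u} {im v} q q′
                }
              ; assoc = λ z w v → ℝ′.+-assoc (re z) (re w) (re v) , ℝ′.+-assoc (im z) (im w) (im v)
              }
            ; identity = (λ z → ℝ′.+-identityˡ (re z) , ℝ′.+-identityˡ (im z))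
                       , (λ z → ℝ′.+-identityʳ (re z) , ℝ′.+-identityʳ (im z))
            }
          ; inverse = (λ z → ℝ′.-‿inverseˡ (re z) , ℝ′.-‿inverseˡ (im z))
                    , (λ z → ℝ′.-‿inverseʳ (re z) , ℝ′.-‿inverseʳ (im z))
          ; ⁻¹-cong = λ {z} {w} (p , q) → ℝ′.-‿cong {re z} {re w} p , ℝ′.-‿cong {im z} {im w} q
          }
        ; comm = λ z w → ℝ′.+-comm (re z) (re w) , ℝ′.+-comm (im z) (im w)
        }
      ; *-cong = λ {z} {w} {u} {v} → *ᶜ-cong {z} {w} {u} {v}
      ; *-assoc = λ z w v → ≈-pointwise {(z *ᶜ w) *ᶜ v} {z *ᶜ (w *ᶜ v)}
          (λ n → assoc-re
            (seq (re z) n) (seq (im z) n) (seq (re w) n) (seq (im w) n) (seq (re v) n) (seq (im v) n))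
          (λ n → assoc-im
            (seq (re z) n) (seq (im z) n) (seq (re w) n) (seq (im w) n) (seq (re v) n) (seq (im v) n))
      ; *-identity = (λ z → ≈-pointwise {1ᶜ *ᶜ z} {z}
                         (λ n → solve 2 (λ a b → con 1ℚ :* a :+ :- (con 0ℚ :* b) := a)
                           ≡.refl (seq (re z) n) (seq (im z) n))
                         (λ n → solve 2 (λ a b → con 1ℚ :* b :+ con 0ℚ :* a := b)
                           ≡.refl (seq (re z) n) (seq (im z) n)))
                   , (λ z → ≈-pointwise {z *ᶜ 1ᶜ} {z}
                         (λ n → solve 2 (λ a b → a :* con 1ℚ :+ :- (b :* con 0ℚ) := a)
                           ≡.refl (seq (re z) n) (seq (im z) n))
                         (λ n → solve 2 (λ a b → a :* con 0ℚ :+ b :* con 1ℚ := b)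
                           ≡.refl (seq (re z) n) (seq (im z) n)))
      ; distrib = (λ z w v → ≈-pointwise {z *ᶜ (w +ᶜ v)} {z *ᶜ w +ᶜ z *ᶜ v}
                    (λ n → solve 6 (λ a b c d e f → a :* (c :+ e) :+ :- (b :* (d :+ f))
                         := (a :* c :+ :- (b :* d)) :+ (a :* e :+ :- (b :* f))) ≡.refl
                      (seq (re z) n) (seq (im z) n) (seq (re w) n) (seq (im w) n) (seq (re v) n) (seq (im v) n))
                    (λ n → solve 6 (λ a b c d e f → a :* (d :+ f) :+ b :* (c :+ e)
                         := (a :* d :+ b :* c) :+ (a :* f :+ b :* e)) ≡.refl
                      (seq (re z) n) (seq (im z) n) (seq (re w) n) (seq (im w) n) (seq (re v) n) (seq (im v) n)))
                , (λ z w v → ≈-pointwise {(w +ᶜ v) *ᶜ z} {w *ᶜ z +ᶜ v *ᶜ z}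
                    (λ n → solve 6 (λ a b c d e f → (c :+ e) :* a :+ :- ((d :+ f) :* b)
                         := (c :* a :+ :- (d :* b)) :+ (e :* a :+ :- (f :* b))) ≡.refl
                      (seq (re z) n) (seq (im z) n) (seq (re w) n) (seq (im w) n) (seq (re v) n) (seq (im v) n))
                    (λ n → solve 6 (λ a b c d e f → (c :+ e) :* b :+ (d :+ f) :* a
                         := (c :* b :+ d :* a) :+ (e :* b :+ f :* a)) ≡.refl
                      (seq (re z) n) (seq (im z) n) (seq (re w) n) (seq (im w) n) (seq (re v) n) (seq (im v) n)))
      }
    ; *-comm = λ z w → ≈-pointwise {z *ᶜ w} {w *ᶜ z}
        (λ n → solve 4 (λ a b c d → a :* c :+ :- (b :* d) := c :* a :+ :- (d :* b)) ≡.refl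
          (seq (re z) n) (seq (im z) n) (seq (re w) n) (seq (im w) n))
        (λ n → solve 4 (λ a b c d → a :* d :+ b :* c := c :* b :+ d :* a) ≡.refl
          (seq (re z) n) (seq (im z) n) (seq (re w) n) (seq (im w) n))
    }
  }
  where
  open +-*-Solver
  *ᶜ-cong : ∀ {z w u v} → z ≈ w → u ≈ v → z *ᶜ u ≈ w *ᶜ v
  *ᶜ-cong {z} {w} {u} {v} (p , q) (p′ , q′) =
    ℝ′.+-cong {re z *ᵣ re u} {re w *ᵣ re v} { -ᵣ (im z *ᵣ im u)} { -ᵣ (im w *ᵣ im v)}
      (ℝ′.*-cong {re z} {re w} {re u} {re v} p p′)
      (ℝ′.-‿cong {im z *ᵣ im u} {im w *ᵣ im v} (ℝ′.*-cong {im z} {im w} {im u} {im v} q q′)) ,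
    ℝ′.+-cong {re z *ᵣ im u} {re w *ᵣ im v} {im z *ᵣ re u} {im w *ᵣ re v}
      (ℝ′.*-cong {re z} {re w} {im u} {im v} p q′) (ℝ′.*-cong {im z} {im w} {re u} {re v} q p′)
  assoc-re : ∀ a b c d e f →
    (a ℚ.* c ℚ.+ ℚ.- (b ℚ.* d)) ℚ.* e ℚ.+ ℚ.- ((a ℚ.* d ℚ.+ b ℚ.* c) ℚ.* f) ≡
    a ℚ.* (c ℚ.* e ℚ.+ ℚ.- (d ℚ.* f)) ℚ.+ ℚ.- (b ℚ.* (c ℚ.* f ℚ.+ d ℚ.* e))
  assoc-re = solve 6 (λ a b c d e f →
    (a :* c :+ :- (b :* d)) :* e :+ :- ((a :* d :+ b :* c) :* f) :=
    a :* (c :* e :+ :- (d :* f)) :+ :- (b :* (c :* f :+ d :* e))) ≡.refl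
  assoc-im : ∀ a b c d e f →
    (a ℚ.* c ℚ.+ ℚ.- (b ℚ.* d)) ℚ.* f ℚ.+ (a ℚ.* d ℚ.+ b ℚ.* c) ℚ.* e ≡
    a ℚ.* (c ℚ.* f ℚ.+ d ℚ.* e) ℚ.+ b ℚ.* (c ℚ.* e ℚ.+ ℚ.- (d ℚ.* f))
  assoc-im = solve 6 (λ a b c d e f →
    (a :* c :+ :- (b :* d)) :* f :+ (a :* d :+ b :* c) :* e :=
    a :* (c :* f :+ d :* e) :+ b :* (c :* e :+ :- (d :* f))) ≡.refl

module ℂ′ = CommutativeRing ℂ-commutativeRing

open RingTheory ℝ-commutativeRing using () renaming (_⨯_ to _⨯ᵣ_)
open RingTheory ℂ-commutativeRing using () renaming (_⨯_ to _⨯ᶜ_)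

-- Null sequences and idempotents

dominated-null : ∀ {s t} c .{{_ : ℚ.Positive c}} → Σ[ N ∈ ℕ ] (∀ n → N ℕ.≤ n → ∣ s n ∣ ℚ.≤ c ℚ.* ∣ t n ∣) →
  Null t → Null s
dominated-null {s} {t} c (M , s≤ct) t→0 ε 0<ε =
  let N , t<δ = t→0 (1/c ℚ.* ε) (*-pos (ℚ.positive⁻¹ 1/c {{ℚ.1/pos⇒pos c}}) 0<ε)
  in M ℕ.⊔ N , λ n l → ℚ.≤-<-trans (s≤ct n (ℕ.m⊔n≤o⇒m≤o M N l))
    (≡.subst (c ℚ.* ∣ t n ∣ ℚ.<_) c*[1/c*ε]≡ε (ℚ.*-monoʳ-<-pos c (t<δ n (ℕ.m⊔n≤o⇒n≤o M N l))))
  where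
  instance
    c-nonZero : ℚ.NonZero c
    c-nonZero = ℚ.pos⇒nonZero c
  1/c : ℚ
  1/c = ℚ.1/ c
  c*[1/c*ε]≡ε : c ℚ.* (1/c ℚ.* ε) ≡ ε
  c*[1/c*ε]≡ε = ≡.trans (≡.sym (ℚ.*-assoc c 1/c ε))
    (≡.trans (≡.cong (ℚ._* ε) (ℚ.*-inverseʳ c)) (ℚ.*-identityˡ ε))

null⇒≈0 : ∀ x → Null (seq x) → x ≈ᵣ fromℚ 0ℚ
null⇒≈0 x = null-resp-≡ (λ n → ≡.sym (ℚ.+-identityʳ (seq x n)))

≈0⇒null : ∀ x → x ≈ᵣ fromℚ 0ℚ → Null (seq x)
≈0⇒null x = null-resp-≡ (λ n → ℚ.+-identityʳ (seq x n))

0≤p*p : ∀ p → 0ℚ ℚ.≤ p ℚ.* p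
0≤p*p p = ≡.subst (0ℚ ℚ.≤_) (≡.sym p*p≡∣p∣*∣p∣) (≡.subst (ℚ._≤ ∣ p ∣ ℚ.* ∣ p ∣) (ℚ.*-zeroʳ ∣ p ∣)
    (ℚ.*-monoˡ-≤-nonNeg ∣ p ∣ {{ℚ.nonNegative (ℚ.0≤∣p∣ p)}} (ℚ.0≤∣p∣ p)))
  where
  p*p≡∣p∣*∣p∣ : p ℚ.* p ≡ ∣ p ∣ ℚ.* ∣ p ∣
  p*p≡∣p∣*∣p∣ with ℚ.∣p∣≡p∨∣p∣≡-p p
  ... | inj₁ eq = ≡.sym (≡.cong₂ ℚ._*_ eq eq)
  ... | inj₂ eq = ≡.trans (solve 1 (λ p → p :* p := :- p :* :- p) ≡.refl p) (≡.sym (≡.cong₂ ℚ._*_ eq eq))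
    where open +-*-Solver

square-cancel-< : ∀ {p q} → 0ℚ ℚ.≤ q → p ℚ.* p ℚ.< q ℚ.* q → p ℚ.< q
square-cancel-< {p} {q} 0≤q p²<q² = ℚ.≰⇒> λ q≤p →
  ℚ.<-irrefl ≡.refl (ℚ.<-≤-trans p²<q² (*-mono-≤ 0≤q 0≤q q≤p q≤p))

square-cancel-≤ : ∀ {p q} → 0ℚ ℚ.≤ q → p ℚ.* p ℚ.≤ q ℚ.* q → p ℚ.≤ q
square-cancel-≤ {p} {q} 0≤q p²≤q² = ℚ.≮⇒≥ λ q<p →
  let 0<p = ℚ.≤-<-trans 0≤q q<p in
  ℚ.<-irrefl ≡.refl (ℚ.<-≤-trans (ℚ.*-monoʳ-<-pos p {{ℚ.positive 0<p}} q<p)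
    (ℚ.≤-trans p²≤q² (ℚ.*-monoʳ-≤-nonNeg q {{ℚ.nonNegative 0≤q}} (ℚ.<⇒≤ q<p))))

square-null : ∀ {s} → Null (λ n → s n ℚ.* s n) → Null s
square-null {s} s²→0 ε 0<ε = let N , p = s²→0 (ε ℚ.* ε) (*-pos 0<ε 0<ε) in
  N , λ n N≤n → square-cancel-< (ℚ.<⇒≤ 0<ε)
    (≡.subst (ℚ._< ε ℚ.* ε) (ℚ.∣p*q∣≡∣p∣*∣q∣ (s n) (s n)) (p n N≤n))

∣∣-mono-≤ : ∀ {p q} → 0ℚ ℚ.≤ p → p ℚ.≤ q → ∣ p ∣ ℚ.≤ ∣ q ∣
∣∣-mono-≤ {p} {q} 0≤p p≤q = ≡.subst (ℚ._≤ ∣ q ∣) (≡.sym (ℚ.0≤p⇒∣p∣≡p 0≤p)) (ℚ.≤-trans p≤q (p≤∣p∣ q))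

-- Together with `dominated-null` this cancels a factor q, bounded below by 1 / c in absolute value,
-- from a null sequence of products p q.
∣p∣≤c∣pq∣ : ∀ {c} .{{_ : ℚ.NonNegative c}} p {q} → 1ℚ ℚ.≤ c ℚ.* ∣ q ∣ → ∣ p ∣ ℚ.≤ c ℚ.* ∣ p ℚ.* q ∣
∣p∣≤c∣pq∣ {c} p {q} 1≤cq = ℚ.≤-trans (ℚ.≤-reflexive (≡.sym (ℚ.*-identityʳ ∣ p ∣)))
  (ℚ.≤-trans (ℚ.*-monoˡ-≤-nonNeg ∣ p ∣ {{ℚ.nonNegative (ℚ.0≤∣p∣ p)}} 1≤cq)
    (ℚ.≤-reflexive (≡.trans (swap (∣ p ∣) c (∣ q ∣)) (≡.cong (c ℚ.*_) (≡.sym (ℚ.∣p*q∣≡∣p∣*∣q∣ p q))))))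
  where
  open +-*-Solver
  swap : ∀ p c q → p ℚ.* (c ℚ.* q) ≡ c ℚ.* (p ℚ.* q)
  swap = solve 3 (λ p c q → p :* (c :* q) := c :* (p :* q)) ≡.refl

¼ 4ℚ : ℚ
¼  = + 1 / 4
4ℚ = + 4 / 1

-- A Cauchy sequence stays eventually on one side of 1/2, hence away from
-- 1 or from 0.
ℝ-idempotent : ∀ x → x *ᵣ x ≈ᵣ x → x ≈ᵣ fromℚ 0ℚ ⊎ x ≈ᵣ fromℚ 1ℚ
ℝ-idempotent x x²≈x with N , close ← cauchy x ¼ (ℚ.positive⁻¹ ¼) = decide (seq x N ℚ.≤? ½)
  where
  open +-*-Solver
  [x-1]x : Null (λ n → (seq x n ℚ.- 1ℚ) ℚ.* seq x n)
  [x-1]x = null-resp-≡ (λ n → solve 1 (λ x → x :* x :- x := (x :- con 1ℚ) :* x) ≡.refl (seq x n)) x²≈x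
  1≤4∣p∣ : ∀ {p} → ¼ ℚ.≤ p → 1ℚ ℚ.≤ 4ℚ ℚ.* ∣ p ∣
  1≤4∣p∣ {p} ¼≤p = ℚ.*-monoˡ-≤-nonNeg 4ℚ (ℚ.≤-trans ¼≤p (p≤∣p∣ p))
  near : ∀ n → N ℕ.≤ n → ∣ seq x n ℚ.- seq x N ∣ ℚ.< ¼
  near n N≤n = close n N N≤n ℕ.≤-refl
  decide : Dec (seq x N ℚ.≤ ½) → x ≈ᵣ fromℚ 0ℚ ⊎ x ≈ᵣ fromℚ 1ℚ
  decide (yes xN≤½) = inj₁ (null⇒≈0 x (dominated-null 4ℚ (N , λ n N≤n →
    ℚ.≤-trans (∣p∣≤c∣pq∣ {4ℚ} (seq x n) {seq x n ℚ.- 1ℚ}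
        (≡.subst (λ q → 1ℚ ℚ.≤ 4ℚ ℚ.* q) (∣p-q∣≡∣q-p∣ 1ℚ (seq x n)) (1≤4∣p∣ (below n N≤n))))
      (ℚ.≤-reflexive (≡.cong (λ q → 4ℚ ℚ.* ∣ q ∣) (ℚ.*-comm (seq x n) (seq x n ℚ.- 1ℚ))))) [x-1]x))
    where
    below : ∀ n → N ℕ.≤ n → ¼ ℚ.≤ 1ℚ ℚ.- seq x n
    below n N≤n = begin
      ¼                        ≡⟨⟩
      1ℚ ℚ.- (¼ ℚ.+ ½)
        ≤⟨ ℚ.+-monoʳ-≤ 1ℚ (ℚ.neg-antimono-≤
             (ℚ.+-mono-≤ (ℚ.≤-trans (p≤∣p∣ _) (ℚ.<⇒≤ (near n N≤n))) xN≤½)) ⟩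
      1ℚ ℚ.- ((seq x n ℚ.- seq x N) ℚ.+ seq x N)
        ≡⟨ solve 2 (λ a b → con 1ℚ :- ((a :- b) :+ b) := con 1ℚ :- a) ≡.refl (seq x n) (seq x N) ⟩
      1ℚ ℚ.- seq x n           ∎
      where open ℚ.≤-Reasoning
  decide (no xN≰½) = inj₂ (dominated-null 4ℚ (N , λ n N≤n →
    ∣p∣≤c∣pq∣ {4ℚ} (seq x n ℚ.- 1ℚ) {seq x n} (1≤4∣p∣ (above n N≤n))) [x-1]x)
    where
    above : ∀ n → N ℕ.≤ n → ¼ ℚ.≤ seq x n
    above n N≤n = begin
      ¼                        ≡⟨⟩
      ½ ℚ.- ¼
        ≤⟨ ℚ.+-mono-≤ (ℚ.<⇒≤ (ℚ.≰⇒> xN≰½)) (ℚ.neg-antimono-≤ (ℚ.≤-trans (p≤∣p∣ _)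
             (ℚ.≤-trans (ℚ.≤-reflexive (∣p-q∣≡∣q-p∣ (seq x N) (seq x n))) (ℚ.<⇒≤ (near n N≤n))))) ⟩
      seq x N ℚ.- (seq x N ℚ.- seq x n)
        ≡⟨ solve 2 (λ a b → a :- (a :- b) := b) ≡.refl (seq x N) (seq x n) ⟩
      seq x n                  ∎
      where open ℚ.≤-Reasoning

-- The imaginary part b satisfies b² + (2b²)² = 0. Termwise b² is at most this sum of squares, so b
-- tends to 0, and the real part is an idempotent of ℝ.
ℂ-idempotent : ∀ e → e *ᶜ e ≈ e → e ≈ 0ᶜ ⊎ e ≈ 1ᶜ
ℂ-idempotent e (re≈ , im≈) = Sum.map (_, b≈0) (_, b≈0) (ℝ-idempotent a
  (RingTheory.square-from-difference ℝ-commutativeRing {a} {b} b≈0 re≈))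
  where
  a b : ℝ
  a = re e
  b = im e
  b≈0 : b ≈ᵣ fromℚ 0ℚ
  b≈0 = null⇒≈0 b (square-null (dominated-null {t = seq (b² +ᵣ [2b²]²)} 1ℚ
    (0 , λ n _ → ℚ.≤-trans
      (∣∣-mono-≤ (0≤p*p (seq b n)) (p≤p+q² (seq b² n) (seq (b² +ᵣ b²) n)))
      (ℚ.≤-reflexive (≡.sym (ℚ.*-identityˡ _))))
    (≈0⇒null (b² +ᵣ [2b²]²)
      (RingTheory.idempotent-imaginary ℝ-commutativeRing a b re≈ im≈))))
    where
    b² [2b²]² : ℝ
    b² = b *ᵣ b
    [2b²]² = (b² +ᵣ b²) *ᵣ (b² +ᵣ b²)
    p≤p+q² : ∀ p q → p ℚ.≤ p ℚ.+ q ℚ.* q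
    p≤p+q² p q = ≡.subst (ℚ._≤ p ℚ.+ q ℚ.* q) (ℚ.+-identityʳ p) (ℚ.+-monoʳ-≤ p (0≤p*p q))

1≉0 : ¬ (1ᶜ ≈ 0ᶜ)
1≉0 (1≈0 , _) = let N , p = 1≈0 1ℚ (ℚ.positive⁻¹ 1ℚ) in ℚ.<-irrefl ≡.refl (p N ℕ.≤-refl)

seq-⨯ : ∀ k n → seq (k ⨯ᵣ fromℚ 1ℚ) n ≡ + k / 1
seq-⨯ zero    n = ≡.refl
seq-⨯ (suc k) n = ≡.trans (≡.cong (1ℚ ℚ.+_) (seq-⨯ k n))
  (≡.trans (ℚ.+-comm 1ℚ (+ k / 1)) (≡.sym (/-suc k 0)))

⨯-re : ∀ k n → seq (re (k ⨯ᶜ 1ᶜ)) n ≡ + k / 1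
⨯-re zero    n = ≡.refl
⨯-re (suc k) n = ≡.trans (≡.cong (1ℚ ℚ.+_) (⨯-re k n))
  (≡.trans (ℚ.+-comm 1ℚ (+ k / 1)) (≡.sym (/-suc k 0)))

⨯-im : ∀ k n → seq (im (k ⨯ᶜ 1ᶜ)) n ≡ 0ℚ
⨯-im zero    n = ≡.refl
⨯-im (suc k) n = ≡.trans (ℚ.+-identityˡ _) (⨯-im k n)

reciprocal : ∀ k .{{_ : NonZero k}} → ∃[ κ ] κ *ᶜ (k ⨯ᶜ 1ᶜ) ≈ 1ᶜ
reciprocal k@(suc _) = κ , ≈-pointwise {κ *ᶜ (k ⨯ᶜ 1ᶜ)} {1ᶜ}
  (λ n → ≡.trans (≡.cong₂ (λ p q → 1/k ℚ.* p ℚ.+ ℚ.- (0ℚ ℚ.* q)) (⨯-re k n) (⨯-im k n))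
    (≡.trans (ℚ.+-identityʳ _) (ℚ.*-inverseˡ (+ k / 1))))
  (λ n → ≡.trans (≡.cong₂ (λ p q → 1/k ℚ.* q ℚ.+ 0ℚ ℚ.* p) (⨯-re k n) (⨯-im k n))
    (≡.cong₂ ℚ._+_ (ℚ.*-zeroʳ 1/k) (ℚ.*-zeroˡ (+ k / 1))))
  where
  instance
    k-nonZero : ℚ.NonZero (+ k / 1)
    k-nonZero = ℚ.pos⇒nonZero (+ k / 1) {{ℚ.normalize-pos k 1}}
  1/k : ℚ
  1/k = ℚ.1/ (+ k / 1)
  κ : ℂ
  κ = fromℚ 1/k +i fromℚ 0ℚ

ℂ-isConnectedℚAlgebra : RingTheory.IsConnectedℚAlgebra ℂ-commutativeRing
ℂ-isConnectedℚAlgebra = record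
  { 1≉0 = 1≉0 ; reciprocal = reciprocal ; idempotent = ℂ-idempotent }

-- Squared moduli of roots of unity

open RingTheory ℝ-commutativeRing using () renaming (_^_ to _^ᵣ_; geometric to geometricᵣ)

∣∣²-cong : ∀ {z w} → z ≈ w → ∣ z ∣² ≈ᵣ ∣ w ∣²
∣∣²-cong {z} {w} (p , q) = ℝ′.+-cong {re z *ᵣ re z} {re w *ᵣ re w} {im z *ᵣ im z} {im w *ᵣ im w}
  (ℝ′.*-cong {re z} {re w} {re z} {re w} p p) (ℝ′.*-cong {im z} {im w} {im z} {im w} q q)

∣∣²-* : ∀ z w → ∣ z *ᶜ w ∣² ≈ᵣ ∣ z ∣² *ᵣ ∣ w ∣²
∣∣²-* z w = ≈ᵣ-pointwise {∣ z *ᶜ w ∣²} {∣ z ∣² *ᵣ ∣ w ∣²} λ n →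
  solve 4 (λ a b c d →
      (a :* c :+ :- (b :* d)) :* (a :* c :+ :- (b :* d)) :+ (a :* d :+ b :* c) :* (a :* d :+ b :* c)
      := (a :* a :+ b :* b) :* (c :* c :+ d :* d)) ≡.refl
    (seq (re z) n) (seq (im z) n) (seq (re w) n) (seq (im w) n)
  where open +-*-Solver

∣∣²-⨯ : ∀ k → ∣ k ⨯ᶜ 1ᶜ ∣² ≈ᵣ (k ⨯ᵣ fromℚ 1ℚ) *ᵣ (k ⨯ᵣ fromℚ 1ℚ)
∣∣²-⨯ k = ≈ᵣ-pointwise {∣ k ⨯ᶜ 1ᶜ ∣²} {(k ⨯ᵣ fromℚ 1ℚ) *ᵣ (k ⨯ᵣ fromℚ 1ℚ)} λ n →
  ≡.trans (≡.cong₂ (λ p q → p ℚ.* p ℚ.+ q ℚ.* q) (⨯-re k n) (⨯-im k n))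
    (≡.trans (ℚ.+-identityʳ _) (≡.sym (≡.cong₂ ℚ._*_ (seq-⨯ k n) (seq-⨯ k n))))

sumᵣ-nonNeg : ∀ {k} (f : Fin k → ℝ) n → (∀ i → 0ℚ ℚ.≤ seq (f i) n) → 0ℚ ℚ.≤ seq (sumᵣ f) n
sumᵣ-nonNeg {zero}  f n 0≤f = ℚ.≤-refl
sumᵣ-nonNeg {suc k} f n 0≤f = ℚ.+-mono-≤ (0≤f zero) (sumᵣ-nonNeg (f ∘ suc) n (0≤f ∘ suc))

^ᵣ-nonNeg : ∀ x n → 0ℚ ℚ.≤ seq x n → ∀ k → 0ℚ ℚ.≤ seq (x ^ᵣ k) n
^ᵣ-nonNeg x n 0≤x zero    = ℚ.nonNegative⁻¹ 1ℚ
^ᵣ-nonNeg x n 0≤x (suc k) = *-mono-≤ ℚ.≤-refl ℚ.≤-refl 0≤x (^ᵣ-nonNeg x n 0≤x k)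

-- The sum G = 1 + x + ... + xᵏ⁻¹ is termwise at least 1, so it can be cancelled from (x - 1) G = 0.
nonNeg-root≈1 : ∀ x → (∀ n → 0ℚ ℚ.≤ seq x n) → ∀ k .{{_ : NonZero k}} → x ^ᵣ k ≈ᵣ fromℚ 1ℚ → x ≈ᵣ fromℚ 1ℚ
nonNeg-root≈1 x 0≤x k@(suc k-1) xᵏ≈1 = dominated-null 1ℚ
  (0 , λ n _ → ∣p∣≤c∣pq∣ {1ℚ} (seq x n ℚ.- 1ℚ) {seq G n} (1≤1*∣G∣ n))
  (null-resp-≡ (λ n → solve 2 (λ x g → x :* g :- g := (x :- con 1ℚ) :* g) ≡.refl (seq x n) (seq G n))
    (RingTheory.geometric-fixed ℝ-commutativeRing k {x} xᵏ≈1))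
  where
  open +-*-Solver
  G : ℝ
  G = geometricᵣ k x
  1≤1*∣G∣ : ∀ n → 1ℚ ℚ.≤ 1ℚ ℚ.* ∣ seq G n ∣
  1≤1*∣G∣ n = ℚ.≤-trans
    (ℚ.+-monoʳ-≤ 1ℚ (sumᵣ-nonNeg {k-1} (λ j → x ^ᵣ suc (toℕ j)) n (λ j → ^ᵣ-nonNeg x n (0≤x n) (suc (toℕ j)))))
    (ℚ.≤-trans (p≤∣p∣ (seq G n)) (ℚ.≤-reflexive (≡.sym (ℚ.*-identityˡ _))))

∣root∣²≈1 : ∀ k .{{_ : NonZero k}} {z} → z ^ k ≈ 1ᶜ → ∣ z ∣² ≈ᵣ fromℚ 1ℚ
∣root∣²≈1 k {z} zᵏ≈1 = nonNeg-root≈1 ∣ z ∣²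
  (λ n → ℚ.+-mono-≤ (0≤p*p (seq (re z) n)) (0≤p*p (seq (im z) n))) k
  (ℝ′.trans {∣ z ∣² ^ᵣ k} {∣ z ^ k ∣²} {fromℚ 1ℚ}
    (ℝ′.sym {∣ z ^ k ∣²} {∣ z ∣² ^ᵣ k}
      (multiplicative-^ ℂ-commutativeRing ℝ-commutativeRing ∣_∣² ∣1∣²≈1 ∣∣²-* z k))
    (ℝ′.trans {∣ z ^ k ∣²} {∣ 1ᶜ ∣²} {fromℚ 1ℚ} (∣∣²-cong {z ^ k} {1ᶜ} zᵏ≈1) ∣1∣²≈1))
  where
  ∣1∣²≈1 : ∣ 1ᶜ ∣² ≈ᵣ fromℚ 1ℚ
  ∣1∣²≈1 = ≈ᵣ-pointwise {∣ 1ᶜ ∣²} {fromℚ 1ℚ} (λ _ → ≡.refl)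

ℂ-squaredModulus : SquaredModulus ℂ-commutativeRing ℝ-commutativeRing
ℂ-squaredModulus = record
  { ∣_∣² = ∣_∣² ; ∣∣²-cong = λ {z} {w} → ∣∣²-cong {z} {w} ; ∣∣²-* = ∣∣²-*
  ; ∣∣²-⨯ = ∣∣²-⨯ ; ∣root∣² = λ k {z} → ∣root∣²≈1 k {z} }

-- Square roots of real numbers

-- Radicands closer than (ε/2)² have approximate roots closer than ε once the mesh 1/(n+1) of the
-- grid is at most ε/2.
√-cong : ∀ x y → x ≈ᵣ y → √ x ≈ᵣ √ y
√-cong x y x≈y ε 0<ε =
  let e = ½ ℚ.* ε
      0<e = half-pos 0<ε
      M , p = x≈y (e ℚ.* e) (*-pos 0<e 0<e)
      M′ , p′ = ≈ᵣ-sym {x} {y} x≈y (e ℚ.* e) (*-pos 0<e 0<e)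
      N , a = archimedean e 0<e
  in M ℕ.⊔ M′ ℕ.⊔ N , λ n l →
    let s = sqrtApprox n (seq x n)
        t = sqrtApprox n (seq y n)
        1/n≤e = a n (ℕ.m⊔n≤o⇒n≤o (M ℕ.⊔ M′) N l)
        MM′≤n = ℕ.m⊔n≤o⇒m≤o (M ℕ.⊔ M′) N l
    in ∣-∣-<
      (≡.subst (s ℚ.- t ℚ.<_) (half+half ε)
        (sqrtApprox-close n n (seq x n) (seq y n) 0<e 1/n≤e (p n (ℕ.m⊔n≤o⇒m≤o M M′ MM′≤n))))
      (≡.subst₂ ℚ._<_ (neg-sub t s) (half+half ε)
        (sqrtApprox-close n n (seq y n) (seq x n) 0<e 1/n≤e (p′ n (ℕ.m⊔n≤o⇒n≤o M M′ MM′≤n))))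
  where
  open +-*-Solver
  neg-sub : ∀ p q → p ℚ.- q ≡ ℚ.- (q ℚ.- p)
  neg-sub = solve 2 (λ p q → p :- q := :- (q :- p)) ≡.refl

-- The bounds on squares give s ≤ q < s + 1/(n+1) for the nth approximation s, as both s and q are
-- nonnegative.
√-square : ∀ q → 0ℚ ℚ.≤ q → √ (fromℚ (q ℚ.* q)) ≈ᵣ fromℚ q
√-square q 0≤q ε 0<ε = let N , a = archimedean ε 0<ε in N , λ n N≤n →
  let s = sqrtApprox n (q ℚ.* q)
      s≤q = upper s (sqrtApprox-lower n (q ℚ.* q))
      q<s+h = square-cancel-< {q} {s ℚ.+ + 1 / suc n}
        (ℚ.+-mono-≤ (sqrtApprox-nonNeg n (q ℚ.* q)) (ℚ.<⇒≤ (1/suc-pos n))) (sqrtApprox-upper n (q ℚ.* q))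
  in ∣-∣-<
    (ℚ.≤-<-trans (≡.subst (s ℚ.- q ℚ.≤_) (ℚ.+-inverseʳ q) (ℚ.+-monoˡ-≤ (ℚ.- q) s≤q)) 0<ε)
    (≡.subst₂ ℚ._<_ (neg-sub q s) (cancel s (+ 1 / suc n)) (ℚ.+-monoˡ-< (ℚ.- s) q<s+h) ⟨ ℚ.<-≤-trans ⟩ a n N≤n)
  where
  open +-*-Solver
  upper : ∀ s → s ≡ 0ℚ ⊎ s ℚ.* s ℚ.≤ q ℚ.* q → s ℚ.≤ q
  -- Here 0 is the default value of the grid search, for which no bound on the square is recorded.
  upper s (inj₁ s≡0)   = ≡.subst (ℚ._≤ q) (≡.sym s≡0) 0≤q
  upper s (inj₂ s²≤q²) = square-cancel-≤ 0≤q s²≤q²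
  neg-sub : ∀ p q → p ℚ.- q ≡ ℚ.- (q ℚ.- p)
  neg-sub = solve 2 (λ p q → p :- q := :- (q :- p)) ≡.refl
  cancel : ∀ s h → (s ℚ.+ h) ℚ.- s ≡ h
  cancel = solve 2 (λ s h → (s :+ h) :- s := h) ≡.refl

-- The condition number

open RootsOfUnity ℂ-commutativeRing ℂ-isConnectedℚAlgebra
open RingTheory ℂ-commutativeRing using (eval; Separated; interpolate; right⇒leftInverse)
open RingTheory ℝ-commutativeRing using (double-sum-const; proportional; ×1-homo-*)

𝟙-diag : ∀ {k} (i : Fin k) → 𝟙 i i ≡ 1ᶜ
𝟙-diag i with i Fin.≟ i
... | yes _  = ≡.refl
... | no i≢i = contradiction ≡.refl i≢i

𝟙-off : ∀ {k} (i j : Fin k) → i ≢ j → 𝟙 i j ≡ 0ᶜ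
𝟙-off i j i≢j with i Fin.≟ j
... | yes i≡j = contradiction i≡j i≢j
... | no _    = ≡.refl

-- Column j of the inverse holds the coefficients of the Lagrange polynomial that is 1 at xⱼ and 0
-- at the other nodes.
vandermonde-invertible : ∀ {k} (x : Fin k → ℂ) → Separated x → Invertible (vandermonde x)
vandermonde-invertible {k} x sep = record
  { inverse  = W
  ; inverseˡ = right⇒leftInverse x sep W 𝟙 (λ i → ℂ′.reflexive (𝟙-diag i))
      (λ i j i≢j → ℂ′.reflexive (𝟙-off i j i≢j)) VW≋𝟙
  ; inverseʳ = VW≋𝟙
  }
  where
  W : Matrix k
  W l j = proj₁ (interpolate x sep (λ i → 𝟙 i j)) l
  VW≋𝟙 : vandermonde x · W ≋ 𝟙
  VW≋𝟙 i j = proj₂ (interpolate x sep (λ i → 𝟙 i j)) i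

module _ {k} (x : Fin k → ℂ) (V⁻¹ : Invertible (vandermonde x)) where

  inverse-diag : ∀ i → eval (λ j → inverse V⁻¹ j i) (x i) ≈ 1ᶜ
  inverse-diag i = ≡.subst (eval (λ j → inverse V⁻¹ j i) (x i) ≈_) (𝟙-diag i) (inverseʳ V⁻¹ i i)

  inverse-off : ∀ i i′ → i ≢ i′ → eval (λ j → inverse V⁻¹ j i′) (x i) ≈ 0ᶜ
  inverse-off i i′ i≢i′ = ≡.subst (eval (λ j → inverse V⁻¹ j i′) (x i) ≈_) (𝟙-off i i′ i≢i′)
    (inverseʳ V⁻¹ i i′)

‖vandermonde‖ : ∀ n .{{_ : NonZero n}} {m} (ζ : Fin m → ℂ) → (∀ i → ζ i ^ n ≈ 1ᶜ) →
  ‖ vandermonde ζ ‖ ≈ᵣ m ⨯ᵣ fromℚ 1ℚ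
‖vandermonde‖ n {m} ζ root = ℝ′.trans {‖ vandermonde ζ ‖} {√ (fromℚ (M ℚ.* M))} {m ⨯ᵣ fromℚ 1ℚ}
  (√-cong S (fromℚ (M ℚ.* M)) (ℝ′.trans {S} {P} {fromℚ (M ℚ.* M)}
    (double-sum-const m m (fromℚ 1ℚ) (λ i j → ∣root∣²≈1 n (root-^ n (root i) (toℕ j))))
    (≈ᵣ-pointwise {P} {fromℚ (M ℚ.* M)} λ k →
      ≡.cong₂ ℚ._*_ (seq-⨯ m k) (≡.trans (ℚ.*-identityʳ _) (seq-⨯ m k)))))
  (ℝ′.trans {√ (fromℚ (M ℚ.* M))} {fromℚ M} {m ⨯ᵣ fromℚ 1ℚ} (√-square M (/-nonNeg m 0))
    (≈ᵣ-pointwise {fromℚ M} {m ⨯ᵣ fromℚ 1ℚ} λ k → ≡.sym (seq-⨯ m k)))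
  where
  M : ℚ
  M = + m / 1
  S P : ℝ
  S = sumᵣ (λ i → sumᵣ (λ j → ∣ vandermonde ζ i j ∣²))
  P = (m ⨯ᵣ fromℚ 1ℚ) *ᵣ ((m ⨯ᵣ fromℚ 1ℚ) *ᵣ fromℚ 1ℚ)

Cond-vandermonde : ∀ q r .{{_ : NonZero q}} .{{_ : NonZero r}} →
  (∀ {p} → Prime p → p ∣ q ℕ.* r → p ∣ r) → ∀ {m m′} (ζ : Fin m → ℂ) (ξ : Fin m′ → ℂ) →
  Enumerates (q ℕ.* r) ζ → Enumerates r ξ → Fin m →
  (V⁻¹ : Invertible (vandermonde ζ)) (U⁻¹ : Invertible (vandermonde ξ)) →
  Cond (vandermonde ζ) V⁻¹ ≈ᵣ (q ⨯ᵣ fromℚ 1ℚ) *ᵣ Cond (vandermonde ξ) U⁻¹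
Cond-vandermonde q r primes {m} {m′} ζ ξ ζ-enum ξ-enum i₀ V⁻¹ U⁻¹ =
  proportional {‖ vandermonde ζ ‖} {‖ vandermonde ξ ‖} {‖ inverse V⁻¹ ‖} {‖ inverse U⁻¹ ‖}
    {q ⨯ᵣ fromℚ 1ℚ} {m ⨯ᵣ fromℚ 1ℚ} {m′ ⨯ᵣ fromℚ 1ℚ}
    (‖vandermonde‖ (q ℕ.* r) {{ℕ.m*n≢0 q r}} ζ (Enumerates.root ζ-enum))
    (‖vandermonde‖ r ξ (Enumerates.root ξ-enum))
    (√-cong (sumᵣ (λ j → sumᵣ (λ i → ∣ inverse V⁻¹ j i ∣²)))
      (sumᵣ (λ b → sumᵣ (λ a → ∣ inverse U⁻¹ b a ∣²)))
      (frobenius-inverse (inverse U⁻¹) (inverse V⁻¹)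
        (inverse-diag ξ U⁻¹) (inverse-off ξ U⁻¹) (inverse-diag ζ V⁻¹) (inverse-off ζ V⁻¹)))
    (≡.subst (λ k → k ⨯ᵣ fromℚ 1ℚ ≈ᵣ (m′ ⨯ᵣ fromℚ 1ℚ) *ᵣ (q ⨯ᵣ fromℚ 1ℚ)) (≡.sym m≡m′*q) (×1-homo-* m′ q))
  where
  open Comparison q r primes ζ ξ ζ-enum ξ-enum i₀
  open Norms ℝ-commutativeRing ℂ-squaredModulus

[q*r]/r≡q : ∀ {n} q r .{{_ : NonZero r}} → n ≡ q ℕ.* r → + n / r ≡ + q / 1
[q*r]/r≡q q r@(suc r-1) ≡.refl = ≡.trans (≡.cong (λ k → + k / r) (ℕ.*-comm q r)) (/-cancel r-1 q)

lists⇒enumerates : ∀ {n} {ζ : Fin (φ n) → ℂ} → ListsPrimitiveRoots n ζ → Enumerates n ζ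
lists⇒enumerates L = record { isPrimitive = arePrimitive ; distinct = distinct ; complete = complete }
  where open ListsPrimitiveRoots L

-- Invertibility is part of the conclusion, so the equality asserted for every choice of inverses is
-- not vacuous.
theorem1p1 : (n : ℕ) .{{_ : NonZero n}} →
    (ζ : Fin (φ n) → ℂ) → ListsPrimitiveRoots n ζ →
    (ξ : Fin (φ (rad n)) → ℂ) → ListsPrimitiveRoots (rad n) ξ →
    Invertible (vandermonde ζ) × Invertible (vandermonde ξ) ×
    ((V⁻¹ : Invertible (vandermonde ζ)) (U⁻¹ : Invertible (vandermonde ξ)) →
    Cond (vandermonde ζ) V⁻¹ ≈ᵣ fromℚ ((+ n / rad n) {{rad-nonZero n}}) *ᵣ Cond (vandermonde ξ) U⁻¹)
theorem1p1 n ζ ζ-lists ξ ξ-lists =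
  vandermonde-invertible ζ (Enumerates.separated ζ-enum) ,
  vandermonde-invertible ξ (Enumerates.separated ξ-enum) ,
  λ V⁻¹ U⁻¹ → scaling (rad∣n n) V⁻¹ U⁻¹
  where
  instance
    r-nonZero : NonZero (rad n)
    r-nonZero = rad-nonZero n
  ζ-enum : Enumerates n ζ
  ζ-enum = lists⇒enumerates ζ-lists
  ξ-enum : Enumerates (rad n) ξ
  ξ-enum = lists⇒enumerates ξ-lists
  scaling : rad n ∣ n → (V⁻¹ : Invertible (vandermonde ζ)) (U⁻¹ : Invertible (vandermonde ξ)) →
    Cond (vandermonde ζ) V⁻¹ ≈ᵣ fromℚ (+ n / rad n) *ᵣ Cond (vandermonde ξ) U⁻¹
  scaling (divides q n≡q*r) V⁻¹ U⁻¹ = ℝ′.trans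
    {Cond (vandermonde ζ) V⁻¹} {(q ⨯ᵣ fromℚ 1ℚ) *ᵣ K} {fromℚ (+ n / rad n) *ᵣ K}
    (Cond-vandermonde q (rad n) {{q-nonZero}}
      (λ pr p∣q*r → prime∣n⇒prime∣rad n pr (≡.subst (_ ∣_) (≡.sym n≡q*r) p∣q*r))
      -- Only the order is rewritten along n = q r; the index type `Fin (φ n)` of ζ stays as it is.
      ζ ξ (≡.subst (λ k → Enumerates k ζ) n≡q*r ζ-enum) ξ-enum (φ-inhabited n) V⁻¹ U⁻¹)
    (ℝ′.*-cong {q ⨯ᵣ fromℚ 1ℚ} {fromℚ (+ n / rad n)} {K} {K}
      (≈ᵣ-pointwise {q ⨯ᵣ fromℚ 1ℚ} {fromℚ (+ n / rad n)} λ k →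
        ≡.trans (seq-⨯ q k) (≡.sym ([q*r]/r≡q q (rad n) n≡q*r)))
      (ℝ′.refl {K}))
    where
    K : ℝ
    K = Cond (vandermonde ξ) U⁻¹
    q-nonZero : NonZero q
    q-nonZero = ℕ.≢-nonZero λ q≡0 → ℕ.≢-nonZero⁻¹ n (≡.trans n≡q*r (≡.cong (ℕ._* rad n) q≡0))
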